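{- Let $M$ be a path-circular matroid and let $e\in E(M)$. Then $M\backslash e$ and $M/e$ are both path-circular matroids.
   Context: Let $G$ be a simple graph. A path of $G$ is written as the ordered list of its (distinct) vertices $u_1,\ldots,u_k$, consecutive ones adjacent; paths with zero vertices ("null paths") and one vertex are allowed. A path-circular collection $\mathcal P$ of $G$ is a collection of (not necessarily distinct) paths of $G$ such that whenever $u_1,\ldots,u_k$ are the vertices in order of a path in $\mathcal P$ and $i\in\{2,\ldots,k-1\}$: (i) $u_i$ has degree $2$ in $G$, and (ii) every path of $\mathcal P$ containing $u_i$ also contains at least one of $u_1,u_k$. If $V(G)=\{v_1,\ldots,v_r\}$, let $N(v_i)=\{p\in\mathcal P: v_i \text{ is a vertex of } p\}$ and let $M(\mathcal P)$ be the transversal matroid on ground set $\mathcal P$ (members of the collection being distinct elements) with presentation $(N(v_1),\ldots,N(v_r))$, i.e. whose independent sets are the sets $\{x_1,\ldots,x_m\}$ of distinct elements for which there are distinct $k_1,\ldots,k_m\in[r]$ with $x_i\in N(v_{k_i})$. A matroid of the form $M(\mathcal P)$ (up to isomorphism) is a path-circular matroid. -}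

module Defs where

open import Data.Bool.Base using (true; false)
open import Data.Empty using (⊥-elim)
open import Data.Fin.Base using (Fin; zero; suc; punchIn; punchOut)
open import Data.Fin.Properties using (_≟_; any?; all?; suc-injective; punchIn-punchOut)
open import Data.Fin.Subset
open import Data.Fin.Subset.Properties
open import Data.List.Base using (List; _∷_; _∷ʳ_)
import Data.List.Membership.DecPropositional as DecMembership
import Data.List.Membership.Propositional as ListMembership
open import Data.List.Relation.Unary.Linked using (Linked)
open import Data.List.Relation.Unary.Unique.Propositional using (Unique)
open import Data.Nat.Base using (ℕ; zero; suc; _≤_; _<_; z≤n; s≤s; s≤s⁻¹)
import Data.Nat.Properties as ℕ
open import Data.Product.Base using (Σ; ∃; _×_; _,_; proj₁; proj₂)
open import Data.Sum.Base using (_⊎_; inj₁; inj₂)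
open import Data.Vec.Base using (Vec; []; _∷_; here; there; lookup; tabulate; insertAt)
open import Data.Vec.Properties using ([]=⇒lookup; lookup⇒[]=; lookup∘tabulate; insertAt-lookup; insertAt-punchIn)
open import Data.Vec.Properties.WithK using ([]=-irrelevant)
open import Function.Base using (_∘_)
open import Function.Bundles using (_⇔_; _↔_; Inverse)
open import Level using (0ℓ)
open import Relation.Binary.Core using (Rel)
import Relation.Binary.Definitions as B
open import Relation.Binary.PropositionalEquality using (_≡_; _≢_; refl; sym; trans; cong; subst)
open import Relation.Nullary.Decidable using (Dec; yes; no; does; map′; _×-dec_; _→-dec_; ¬?; decidable-stable)
open import Relation.Nullary.Negation using (¬_; contradiction)
open import Relation.Unary using (Pred; Decidable)

private
  variable
    m n r : ℕ

------------------------------------------------------------------------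
-- Finite matroids

-- Decidability of independence is automatic classically; it is what lets
-- contraction distinguish loops from non-loops.

record Matroid (n : ℕ) : Set₁ where
  field
    Indep     : Pred (Subset n) 0ℓ
    indep?    : Decidable Indep
    indep-⊥   : Indep ⊥
    indep-⊆   : ∀ {I J} → I ⊆ J → Indep J → Indep I
    indep-aug : ∀ {I J} → Indep I → Indep J → ∣ I ∣ < ∣ J ∣ →
                ∃ λ x → x ∈ J × x ∉ I × Indep (I ∪ ⁅ x ⁆)

open Matroid

image : Fin m ↔ Fin n → Subset m → Subset n
image σ X = tabulate (λ j → lookup X (Inverse.from σ j))

record _≅_ (M : Matroid m) (N : Matroid n) : Set where
  field
    bijection : Fin m ↔ Fin n
    indep⇔    : ∀ X → Indep M X ⇔ Indep N (image bijection X)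

infix 4 _≅_

------------------------------------------------------------------------
-- Single-element deletion and contraction

-- The ground set E - e of a matroid on Fin (suc n) is identified with Fin n
-- through punchIn e.  A subset X of E - e, seen in E, is then
-- insertAt X e outside, while X ∪ {e} is insertAt X e inside.

insertAt-⊆ : ∀ (X : Subset n) Y e b → X ⊆ Y → insertAt X e b ⊆ insertAt Y e b
insertAt-⊆ X       Y       zero    b X⊆Y here      = here
insertAt-⊆ X       Y       zero    b X⊆Y (there p) = there (X⊆Y p)
insertAt-⊆ (x ∷ X) (y ∷ Y) (suc e) b X⊆Y here with here ← X⊆Y here = here
insertAt-⊆ (x ∷ X) (y ∷ Y) (suc e) b X⊆Y (there p) =
  there (insertAt-⊆ X Y e b (drop-∷-⊆ X⊆Y) p)

insertAt-∪ : ∀ (X : Subset n) e b y →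
             insertAt X e b ∪ ⁅ punchIn e y ⁆ ≡ insertAt (X ∪ ⁅ y ⁆) e b
insertAt-∪ X       zero    false y       = refl
insertAt-∪ X       zero    true  y       = refl
insertAt-∪ (x ∷ X) (suc e) b     zero    = cong (_ ∷_) (insertAt-∪-⊥ X e b)
  where
  insertAt-∪-⊥ : ∀ {n} (X : Subset n) e b → insertAt X e b ∪ ⊥ ≡ insertAt (X ∪ ⊥) e b
  insertAt-∪-⊥ X e b =
    trans (∪-identityʳ (insertAt X e b)) (cong (λ Z → insertAt Z e b) (sym (∪-identityʳ X)))
insertAt-∪ (x ∷ X) (suc e) b     (suc y) = cong (_ ∷_) (insertAt-∪ X e b y)

insertAt-⊥-outside : ∀ {n} (e : Fin (suc n)) → insertAt ⊥ e outside ≡ ⊥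
insertAt-⊥-outside         zero    = refl
insertAt-⊥-outside {suc n} (suc e) = cong (outside ∷_) (insertAt-⊥-outside e)

insertAt-⊥-inside : ∀ {n} (e : Fin (suc n)) → insertAt ⊥ e inside ≡ ⁅ e ⁆
insertAt-⊥-inside         zero    = refl
insertAt-⊥-inside {suc n} (suc e) = cong (outside ∷_) (insertAt-⊥-inside e)

∣insertAt∣ : ∀ (X : Subset n) e b → ∣ insertAt X e b ∣ ≡ ∣ b ∷ X ∣
∣insertAt∣ X           zero    b     = refl
∣insertAt∣ (false ∷ X) (suc e) false = ∣insertAt∣ X e false
∣insertAt∣ (false ∷ X) (suc e) true  = ∣insertAt∣ X e true
∣insertAt∣ (true  ∷ X) (suc e) false = cong suc (∣insertAt∣ X e false)
∣insertAt∣ (true  ∷ X) (suc e) true  = cong suc (∣insertAt∣ X e true)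

insertAt-< : ∀ (X Y : Subset n) e b → ∣ X ∣ < ∣ Y ∣ → ∣ insertAt X e b ∣ < ∣ insertAt Y e b ∣
insertAt-< X Y e b X<Y rewrite ∣insertAt∣ X e b | ∣insertAt∣ Y e b = go b
  where
  go : ∀ b → ∣ b ∷ X ∣ < ∣ b ∷ Y ∣
  go false = X<Y
  go true  = s≤s X<Y

slice : (M : Matroid (suc n)) (e : Fin (suc n)) (b : Side) →
        Indep M (insertAt ⊥ e b) → Matroid n
slice M e b ind = record
  { Indep     = λ X → Indep M (insertAt X e b)
  ; indep?    = λ X → indep? M (insertAt X e b)
  ; indep-⊥   = ind
  ; indep-⊆   = λ {I} {J} I⊆J → indep-⊆ M (insertAt-⊆ I J e b I⊆J)
  ; indep-aug = aug
  }
  where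
  aug : ∀ {I J} → Indep M (insertAt I e b) → Indep M (insertAt J e b) → ∣ I ∣ < ∣ J ∣ →
        ∃ λ x → x ∈ J × x ∉ I × Indep M (insertAt (I ∪ ⁅ x ⁆) e b)
  aug {I} {J} iI iJ I<J with indep-aug M iI iJ (insertAt-< I J e b I<J)
  ... | x , x∈J , x∉I , ix with e ≟ x
  ...   | yes refl = contradiction
          (lookup⇒[]= e _ (trans (insertAt-lookup I e b)
                          (trans (sym (insertAt-lookup J e b)) ([]=⇒lookup x∈J))))
          x∉I
  ...   | no e≢x = y
          , lookup⇒[]= y J (trans (sym (insertAt-punchIn J e b y)) ([]=⇒lookup (subst (_∈ _) (sym y≡x) x∈J)))
          , (λ y∈I → x∉I (subst (_∈ insertAt I e b) y≡x
              (lookup⇒[]= _ _ (trans (insertAt-punchIn I e b y) ([]=⇒lookup y∈I)))))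
          , subst (Indep M) (insertAt-∪ I e b y)
              (subst (λ z → Indep M (insertAt I e b ∪ ⁅ z ⁆)) (sym y≡x) ix)
    where
    y = punchOut e≢x
    y≡x : punchIn e y ≡ x
    y≡x = punchIn-punchOut e≢x

infixl 6 _\\_ _//_

_\\_ : Matroid (suc n) → Fin (suc n) → Matroid n
M \\ e = slice M e outside (subst (Indep M) (sym (insertAt-⊥-outside e)) (indep-⊥ M))

_//_ : Matroid (suc n) → Fin (suc n) → Matroid n
M // e with indep? M ⁅ e ⁆
... | yes ind = slice M e inside (subst (Indep M) (sym (insertAt-⊥-inside e)) ind)
... | no  _   = M \\ e

------------------------------------------------------------------------
-- Transversal matroids

record Matching (N : Fin r → Subset n) (X : Subset n) : Set where
  field
    match     : ∀ x → x ∈ X → Fin r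
    match-∈   : ∀ x p → x ∈ N (match x p)
    injective : ∀ {x y} p q → match x p ≡ match y q → x ≡ y

open Matching

any-vec? : ∀ n {P : Pred (Vec (Fin m) n) 0ℓ} → Decidable P → Dec (∃ P)
any-vec? zero    P? = map′ ([] ,_) (λ { ([] , p) → p }) (P? [])
any-vec? (suc n) P? = map′
  (λ { (x , v , p) → x ∷ v , p }) (λ { (x ∷ v , p) → x , v , p })
  (any? λ x → any-vec? n λ v → P? (x ∷ v))

∈-dec : ∀ (X : Subset n) x {Q : x ∈ X → Set} → (∀ p → Dec (Q p)) → Dec (Σ (x ∈ X) Q)
∈-dec X x {Q} Q? with x ∈? X
... | no x∉X = no (x∉X ∘ proj₁)
... | yes p  = map′ (p ,_) (λ { (q , s) → subst Q ([]=-irrelevant q p) s }) (Q? p)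

matching? : (N : Fin r → Subset n) → Decidable (Matching N)
matching? {r} {n} N X = map′ to from (any-vec? n good?)
  where
  Good : Vec (Fin (suc r)) n → Set
  Good v = (∀ x → x ∈ X → ∃ λ j → lookup v x ≡ suc j × x ∈ N j)
         × (∀ x y → x ∈ X → y ∈ X → lookup v x ≡ lookup v y → x ≡ y)

  good? : Decidable Good
  good? v = (all? λ x → (x ∈? X) →-dec any? λ j → (lookup v x ≟ suc j) ×-dec (x ∈? N j))
      ×-dec (all? λ x → all? λ y → (x ∈? X) →-dec ((y ∈? X) →-dec ((lookup v x ≟ lookup v y) →-dec (x ≟ y))))

  to : ∃ Good → Matching N X
  to (v , a , b) = record
    { match     = λ x p → proj₁ (a x p)
    ; match-∈   = λ x p → proj₂ (proj₂ (a x p))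
    ; injective = λ {x} {y} p q eq → b x y p q
        (trans (proj₁ (proj₂ (a x p))) (trans (cong suc eq) (sym (proj₁ (proj₂ (a y q))))))
    }

  from : Matching N X → ∃ Good
  from M = tabulate f
    , (λ x p → match M x p , trans (lookup∘tabulate f x) (f≡ x p) , match-∈ M x p)
    , (λ x y p q eq → injective M p q (suc-injective
        (trans (sym (trans (lookup∘tabulate f x) (f≡ x p)))
        (trans eq (trans (lookup∘tabulate f y) (f≡ y q))))))
    where
    f : Fin n → Fin (suc r)
    f x with x ∈? X
    ... | yes p = suc (match M x p)
    ... | no  _ = zero

    f≡ : ∀ x p → f x ≡ suc (match M x p)
    f≡ x p with x ∈? X
    ... | yes q   = cong (suc ∘ match M x) ([]=-irrelevant q p)
    ... | no  x∉X = contradiction p x∉X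

∣∣-injective-≤ : ∀ (J : Subset m) (I : Subset n) (h : ∀ x → x ∈ J → Fin n) →
                 (∀ x p → h x p ∈ I) → (∀ {x y} p q → h x p ≡ h y q → x ≡ y) → ∣ J ∣ ≤ ∣ I ∣
∣∣-injective-≤ []            I h into inj = z≤n
∣∣-injective-≤ (outside ∷ J) I h into inj =
  ∣∣-injective-≤ J I (λ x p → h (suc x) (there p)) (λ x p → into (suc x) (there p))
    (λ p q eq → suc-injective (inj (there p) (there q) eq))
∣∣-injective-≤ (inside ∷ J)  I h into inj = ℕ.≤-<-trans
  (∣∣-injective-≤ J (I - h zero here) (λ x p → h (suc x) (there p))
    (λ x p → x∈p∧x≢y⇒x∈p-y (into (suc x) (there p))
      (λ eq → contradiction (inj (there p) here eq) λ ()))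
    (λ p q eq → suc-injective (inj (there p) (there q) eq)))
  (x∈p⇒∣p-x∣<∣p∣ (into zero here))

module _ {N : Fin r → Subset n} where

  free : ∀ {I J} (k : Matching N I) (l : Matching N J) → ∣ I ∣ < ∣ J ∣ →
         ∃ λ y → Σ (y ∈ J) λ q → ∀ x p → match k x p ≢ match l y q
  free {I} {J} k l I<J with any? (λ y → ∈-dec J y (λ q → ¬? (hit? (match l y q))))
    where
    hit? : ∀ j → Dec (∃ λ x → Σ (x ∈ I) λ p → match k x p ≡ j)
    hit? j = any? λ x → ∈-dec I x λ p → match k x p ≟ j
  ... | yes (y , q , ¬hit) = y , q , λ x p eq → ¬hit (x , p , eq)
  ... | no ¬free = contradiction
        (∣∣-injective-≤ J I (λ y q → proj₁ (hit y q)) (λ y q → proj₁ (proj₂ (hit y q))) inj)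
        (ℕ.<⇒≱ I<J)
    where
    hit : ∀ y (q : y ∈ J) → ∃ λ x → Σ (x ∈ I) λ p → match k x p ≡ match l y q
    hit y q = decidable-stable (any? λ x → ∈-dec I x λ p → match k x p ≟ match l y q)
                (λ ¬h → ¬free (y , q , ¬h))

    inj : ∀ {y z} q s → proj₁ (hit y q) ≡ proj₁ (hit z s) → y ≡ z
    inj {y} {z} q s eq with hit y q | hit z s
    inj q s refl | x , p , e | .x , p′ , e′ =
      injective l q s (trans (sym e) (trans (cong (match k x) ([]=-irrelevant p p′)) e′))

  update : ∀ {I I′ y} (k : Matching N I) j → y ∈ N j → (∀ x p → match k x p ≢ j) →
           (∀ {x} → x ∈ I′ → x ≢ y → x ∈ I) → Matching N I′
  update {I} {I′} {y} k j y∈Nj fresh old = record { match = f ; match-∈ = f-∈ ; injective = f-inj }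
    where
    f : ∀ x → x ∈ I′ → Fin r
    f x p with x ≟ y
    ... | yes _  = j
    ... | no x≢y = match k x (old p x≢y)

    f-∈ : ∀ x p → x ∈ N (f x p)
    f-∈ x p with x ≟ y
    ... | yes refl = y∈Nj
    ... | no x≢y   = match-∈ k x (old p x≢y)

    f-inj : ∀ {x z} p q → f x p ≡ f z q → x ≡ z
    f-inj {x} {z} p q eq with x ≟ y | z ≟ y
    ... | yes refl | yes refl = refl
    ... | yes _    | no z≢y   = contradiction (sym eq) (fresh z _)
    ... | no x≢y   | yes _    = contradiction eq (fresh x _)
    ... | no x≢y   | no z≢y   = injective k _ _ eq

  -- Induction on the number of elements outside A, a set on which the two
  -- matchings agree.
  augment : ∀ s {I J} (A : Subset n) (k : Matching N I) (l : Matching N J) →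
            ∣ ∁ A ∣ < s → (∀ {x} → x ∈ A → ∀ p q → match k x p ≡ match l x q) →
            ∣ I ∣ < ∣ J ∣ → ∃ λ x → x ∈ J × x ∉ I × Matching N (I ∪ ⁅ x ⁆)
  augment (suc s) {I} {J} A k l A<s agree I<J with free k l I<J
  ... | y , y∈J , fresh with y ∈? I
  ...   | no y∉I = y , y∈J , y∉I , update k _ (match-∈ l y y∈J) fresh old
    where
    old : ∀ {x} → x ∈ I ∪ ⁅ y ⁆ → x ≢ y → x ∈ I
    old p x≢y with x∈p∪q⁻ I ⁅ y ⁆ p
    ... | inj₁ x∈I = x∈I
    ... | inj₂ x∈y = contradiction (x∈⁅y⁆⇒x≡y y x∈y) x≢y
  ...   | yes y∈I = augment s (A ∪ ⁅ y ⁆) k′ l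
            (ℕ.<-≤-trans (p⊂q⇒∣p∣<∣q∣ smaller) (s≤s⁻¹ A<s)) agree′ I<J
    where
    k′ : Matching N I
    k′ = update k (match l y y∈J) (match-∈ l y y∈J) fresh (λ p _ → p)

    smaller : ∁ (A ∪ ⁅ y ⁆) ⊂ ∁ A
    smaller = (λ p → x∉p⇒x∈∁p (λ a → x∈∁p⇒x∉p p (x∈p∪q⁺ (inj₁ a))))
            , y
            , x∉p⇒x∈∁p (λ a → fresh y y∈I (agree a y∈I y∈J))
            , λ p → x∈∁p⇒x∉p p (x∈p∪q⁺ (inj₂ (x∈⁅x⁆ y)))

    agree′ : ∀ {x} → x ∈ A ∪ ⁅ y ⁆ → ∀ p q → match k′ x p ≡ match l x q
    agree′ {x} a p q with x ≟ y
    ... | yes refl = cong (match l x) ([]=-irrelevant y∈J q)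
    ... | no x≢y with x∈p∪q⁻ A ⁅ y ⁆ a
    ...   | inj₁ x∈A = agree x∈A p q
    ...   | inj₂ x∈y = contradiction (x∈⁅y⁆⇒x≡y y x∈y) x≢y

transversalMatroid : (Fin r → Subset n) → Matroid n
transversalMatroid N = record
  { Indep     = Matching N
  ; indep?    = matching? N
  ; indep-⊥   = record
    { match     = λ _ p → ⊥-elim (∉⊥ p)
    ; match-∈   = λ _ p → ⊥-elim (∉⊥ p)
    ; injective = λ p _ _ → ⊥-elim (∉⊥ p)
    }
  ; indep-⊆   = λ I⊆J k → record
    { match     = λ x p → match k x (I⊆J p)
    ; match-∈   = λ x p → match-∈ k x (I⊆J p)
    ; injective = λ p q → injective k (I⊆J p) (I⊆J q)
    }
  ; indep-aug = λ k l → augment _ ⊥ k l ℕ.≤-refl (λ p → ⊥-elim (∉⊥ p))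
  }

------------------------------------------------------------------------
-- Graphs, paths and path-circular matroids

record SimpleGraph (r : ℕ) : Set₁ where
  field
    _~_      : Rel (Fin r) 0ℓ
    _~?_     : B.Decidable _~_
    ~-sym    : B.Symmetric _~_
    ~-irrefl : B.Irreflexive _≡_ _~_

  degree : Fin r → ℕ
  degree v = ∣ tabulate (λ w → does (v ~? w)) ∣

record Path (G : SimpleGraph r) : Set where
  open SimpleGraph G
  field
    vertices : List (Fin r)
    distinct : Unique vertices
    linked   : Linked _~_ vertices

open Path

_∈ᵖ_ : {G : SimpleGraph r} → Fin r → Path G → Set
v ∈ᵖ p = v ListMembership.∈ vertices p

_∈ᵖ?_ : {G : SimpleGraph r} (v : Fin r) (p : Path G) → Dec (v ∈ᵖ p)
v ∈ᵖ? p = DecMembership._∈?_ _≟_ v (vertices p)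

infix 4 _∈ᵖ_ _∈ᵖ?_

-- The vertices u₁ ∷ us ∷ʳ uₖ of a path with at least two vertices split into
-- its two ends and the list us of its internal vertices u₂ , … , uₖ₋₁.

IsPathCircular : {G : SimpleGraph r} → (Fin n → Path G) → Set
IsPathCircular {G = G} P =
  ∀ i u₁ us uₖ → vertices (P i) ≡ u₁ ∷ (us ∷ʳ uₖ) →
  ∀ u → u ListMembership.∈ us →
    SimpleGraph.degree G u ≡ 2 ×
    (∀ j → u ∈ᵖ P j → u₁ ∈ᵖ P j ⊎ uₖ ∈ᵖ P j)

neighbourhood : {G : SimpleGraph r} → (Fin n → Path G) → Fin r → Subset n
neighbourhood P v = tabulate (λ i → does (v ∈ᵖ? P i))

pathMatroid : {G : SimpleGraph r} → (Fin n → Path G) → Matroid n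
pathMatroid P = transversalMatroid (neighbourhood P)

record PathCircularMatroid (M : Matroid n) : Set₁ where
  field
    {order size} : ℕ
    graph        : SimpleGraph order
    collection   : Fin size → Path graph
    pathCircular : IsPathCircular collection
    iso          : M ≅ pathMatroid collection

{-# OPTIONS --safe #-}
module Submission where

-- A collection of paths with distinct vertices is path-circular in some graph iff,
-- for all its members p and q, (i) the neighbours on q of an interior vertex of p
-- are neighbours of it on p, and (ii) if p and q meet, then q contains an end of p.
-- Deleting an element drops a path, and contracting a null path is a deletion.
--
-- To contract e = u₁ … uₖ, every other path q is replaced by a path q′ on V - u₁
-- consisting of the vertices v ≠ u₁ such that v or its predecessor on e is in q.
-- By (i), (ii) and connectedness, q ∩ e is an initial and a final segment of e, so
-- q′ arises from q by adding at most one vertex b, the first one of e missing from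
-- q (its predecessor on e is then an end of q), and removing u₁.
--
-- A matching of X ∪ {e} by the old paths is a matching of X missing some uᵢ.  Moving
-- the elements matched to uᵢ₋₁ , … , u₁ one step further along e makes u₁ the missing
-- vertex.  Conversely, given a matching by the paths q′, scan e from u₁ on: an
-- element x matched to some uⱼ not in its q has uⱼ₋₁, hence the whole initial segment
-- up to uⱼ₋₁, in q, and so can be moved to the vertex missed so far.

open import Defs
open import Data.Fin.Base using (Fin; zero; suc; punchIn; punchOut)
open import Data.Fin.Properties using (_≟_; any?; punchIn-injective; punchIn-punchOut; punchInᵢ≢i)
open import Data.Fin.Subset using (Subset; inside; outside; ⁅_⁆; ∣_∣; ⊤) renaming (_∈_ to _∈ˢ_)
open import Data.Fin.Subset.Properties using (∈⊤; x∈⁅x⁆) renaming (_∈?_ to _∈ˢ?_)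
open import Data.List.Base using (List; []; _∷_; _∷ʳ_; filter; length; initLast; _∷ʳ′_)
import Data.List.Membership.DecPropositional as DecMembership
open import Data.List.Membership.Propositional using (_∈_; _∉_)
open import Data.List.Membership.Propositional.Properties using (∈-filter⁺; ∈-filter⁻; ∈-++⁻; ∈-++⁺ˡ)
open import Data.List.Relation.Unary.All using (All; []; _∷_)
import Data.List.Relation.Unary.All as All
open import Data.List.Relation.Unary.All.Properties using (All¬⇒¬Any; ¬Any⇒All¬)
open import Data.List.Relation.Unary.AllPairs using ([]; _∷_)
open import Data.List.Relation.Unary.Any using (here; there)
open import Data.List.Relation.Unary.Linked using (Linked; []; [-]; _∷_)
open import Data.List.Relation.Unary.Unique.Propositional using (Unique)
import Data.List.Relation.Unary.Unique.Propositional.Properties as Unique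
open import Data.Nat.Base using (ℕ; zero; suc; _+_; _≤_; _<_; z≤n; s≤s; s≤s⁻¹)
import Data.Nat.Properties as ℕ
open import Data.Product.Base using (∃; ∃₂; _×_; _,_; proj₁; proj₂)
open import Data.Sum.Base using (_⊎_; inj₁; inj₂; [_,_]; swap)
import Data.Sum.Base as Sum
open import Data.Vec.Base using (insertAt)
import Data.Vec.Base as Vec
open import Data.Vec.Functional using (updateAt)
import Data.Vec.Functional as Vector
open import Data.Vec.Functional.Properties using (updateAt-updates; updateAt-minimal)
import Data.Vec.Functional.Properties as VectorP
open import Data.Vec.Properties using ([]=⇒lookup; lookup⇒[]=; lookup∘tabulate; tabulate∘lookup; insertAt-lookup; insertAt-punchIn)
open import Data.Vec.Properties.WithK using ([]=-irrelevant)
open import Function.Base using (_∘_; id; case_of_; const)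
open import Function.Bundles using (_⇔_; _↔_; mk⇔; Equivalence; Inverse)
open import Function.Construct.Composition using (_⇔-∘_)
open import Function.Construct.Identity using (↔-id)
open import Level using (0ℓ)
open import Relation.Binary.Core using (Rel)
open import Relation.Binary.Definitions using (DecidableEquality; tri<; tri≈; tri>)
open import Relation.Binary.PropositionalEquality using (_≡_; _≢_; refl; sym; trans; cong; subst)
open import Relation.Nullary.Decidable using (Dec; yes; no; does; dec-true; map′; _×-dec_; _⊎-dec_; ¬?)
open import Relation.Nullary.Negation using (¬_; contradiction)

-- Paths as lists

private
  variable
    A : Set
    b u v w x y z : A
    l : List A
    i j m n r : ℕ

data Next (x y : A) : List A → Set where
  here  : Next x y (x ∷ y ∷ l)
  there : Next x y l → Next x y (w ∷ l)

data First (x : A) : List A → Set where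
  here : First x (x ∷ l)

data Last (x : A) : List A → Set where
  here  : Last x (x ∷ [])
  there : Last x l → Last x (w ∷ l)

data At {A : Set} : List A → ℕ → A → Set where
  here  : ∀ {x l} → At (x ∷ l) zero x
  there : ∀ {x w l i} → At l i x → At (w ∷ l) (suc i) x

Adj : List A → A → A → Set
Adj p x y = Next x y p ⊎ Next y x p

End : List A → A → Set
End p x = First x p ⊎ Last x p

Interior : List A → A → Set
Interior p x = (∃ λ y → Next y x p) × (∃ λ y → Next x y p)

head-∉ : Unique (x ∷ l) → x ∉ l
head-∉ (x# ∷ _) = All¬⇒¬Any x#

unique-∷ : x ∉ l → Unique l → Unique (x ∷ l)
unique-∷ x∉l ul = ¬Any⇒All¬ _ x∉l ∷ ul

unique-∷ʳ : Unique l → x ∉ l → Unique (l ∷ʳ x)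
unique-∷ʳ ul x∉l = Unique.++⁺ ul ([] ∷ []) λ { (p , here refl) → x∉l p }

first-∈ : First x l → x ∈ l
first-∈ here = here refl

last-∈ : Last x l → x ∈ l
last-∈ here      = here refl
last-∈ (there f) = there (last-∈ f)

end-∈ : End l x → x ∈ l
end-∈ = [ first-∈ , last-∈ ]

next-∈ˡ : Next x y l → x ∈ l
next-∈ˡ here      = here refl
next-∈ˡ (there n) = there (next-∈ˡ n)

next-∈-tail : Next x y (w ∷ l) → y ∈ l
next-∈-tail here          = here refl
next-∈-tail (there {l = _ ∷ _} n) = there (next-∈-tail n)

next-∈ʳ : Next x y l → y ∈ l
next-∈ʳ {l = _ ∷ _} n = there (next-∈-tail n)

next-∷⁻ : Next x y (w ∷ l) → Next x y l ⊎ (x ≡ w × First y l)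
next-∷⁻ here      = inj₂ (refl , here)
next-∷⁻ (there n) = inj₁ n

adj-sym : Adj l x y → Adj l y x
adj-sym = swap

adj-∈ˡ : Adj l x y → x ∈ l
adj-∈ˡ = [ next-∈ˡ , next-∈ʳ ]

adj-∈ʳ : Adj l x y → y ∈ l
adj-∈ʳ = adj-∈ˡ ∘ adj-sym

first-no-pred : Unique l → First x l → ¬ Next y x l
first-no-pred ul here n = head-∉ ul (next-∈-tail n)

last-no-succ : Unique l → Last x l → ¬ Next x y l
last-no-succ ul         (there f) here      = head-∉ ul (last-∈ f)
last-no-succ (_ ∷ ul)   (there f) (there n) = last-no-succ ul f n

next-functional : Unique l → Next x y l → Next x z l → y ≡ z
next-functional ul       here      here      = refl
next-functional ul       here      (there m) = contradiction (next-∈ˡ m) (head-∉ ul)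
next-functional ul       (there n) here      = contradiction (next-∈ˡ n) (head-∉ ul)
next-functional (_ ∷ ul) (there n) (there m) = next-functional ul n m

next-injective : Unique l → Next x z l → Next y z l → x ≡ y
next-injective ul       here      here      = refl
next-injective (_ ∷ ul) here      (there m) = contradiction m (first-no-pred ul here)
next-injective (_ ∷ ul) (there n) here      = contradiction n (first-no-pred ul here)
next-injective (_ ∷ ul) (there n) (there m) = next-injective ul n m

next-asym : Unique l → Next x y l → ¬ Next y x l
next-asym ul       here      n         = head-∉ ul (next-∈-tail n)
next-asym ul       (there n) here      = head-∉ ul (next-∈ʳ n)
next-asym (_ ∷ ul) (there n) (there m) = next-asym ul n m

next-irrefl : Unique l → ¬ Next x x l
next-irrefl ul n = next-asym ul n n

adj-irrefl : Unique l → ¬ Adj l x x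
adj-irrefl ul = [ next-irrefl ul , next-irrefl ul ]

first-or-pred : x ∈ l → First x l ⊎ (∃ λ y → Next y x l)
first-or-pred (here refl) = inj₁ here
first-or-pred (there x∈l) with first-or-pred x∈l
... | inj₁ here    = inj₂ (_ , here)
... | inj₂ (_ , n) = inj₂ (_ , there n)

last-or-succ : x ∈ l → Last x l ⊎ (∃ λ y → Next x y l)
last-or-succ {l = _ ∷ []}    (here refl) = inj₁ here
last-or-succ {l = _ ∷ _ ∷ _} (here refl) = inj₂ (_ , here)
last-or-succ                 (there x∈l) with last-or-succ x∈l
... | inj₁ f       = inj₁ (there f)
... | inj₂ (_ , n) = inj₂ (_ , there n)

end-or-interior : x ∈ l → End l x ⊎ Interior l x
end-or-interior x∈l with first-or-pred x∈l | last-or-succ x∈l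
... | inj₁ f | _      = inj₁ (inj₁ f)
... | inj₂ _ | inj₁ f = inj₁ (inj₂ f)
... | inj₂ n | inj₂ m = inj₂ (n , m)

interior-∈ : Interior l x → x ∈ l
interior-∈ ((_ , n) , _) = next-∈ʳ n

interior-¬end : Unique l → Interior l x → ¬ End l x
interior-¬end ul ((_ , n) , _) (inj₁ f) = first-no-pred ul f n
interior-¬end ul (_ , (_ , n)) (inj₂ f) = last-no-succ ul f n

interior-neighbours : Unique l → Interior l u → ∃₂ λ x y → x ≢ y × Adj l u x × Adj l u y
interior-neighbours ul ((_ , n) , (_ , m)) =
  _ , _ , (λ { refl → next-asym ul n m }) , inj₂ n , inj₁ m

-- A vertex of a duplicate-free list has at most one predecessor and at most one successor, so two
-- distinct neighbours are one of each.
neighbours-interior : Unique l → x ≢ y → Adj l u x → Adj l u y → Interior l u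
neighbours-interior ul x≢y (inj₁ n) (inj₁ m) = contradiction (next-functional ul n m) x≢y
neighbours-interior ul x≢y (inj₁ n) (inj₂ m) = (_ , m) , (_ , n)
neighbours-interior ul x≢y (inj₂ n) (inj₁ m) = (_ , n) , (_ , m)
neighbours-interior ul x≢y (inj₂ n) (inj₂ m) = contradiction (next-injective ul n m) x≢y

at-most-two-neighbours : Unique l → x ≢ y → Adj l u x → Adj l u y → Adj l u v → v ≡ x ⊎ v ≡ y
at-most-two-neighbours ul x≢y (inj₁ n) (inj₁ m) _        = contradiction (next-functional ul n m) x≢y
at-most-two-neighbours ul x≢y (inj₂ n) (inj₂ m) _        = contradiction (next-injective ul n m) x≢y
at-most-two-neighbours ul x≢y (inj₁ n) (inj₂ m) (inj₁ k) = inj₁ (next-functional ul k n)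
at-most-two-neighbours ul x≢y (inj₁ n) (inj₂ m) (inj₂ k) = inj₂ (next-injective ul k m)
at-most-two-neighbours ul x≢y (inj₂ n) (inj₁ m) (inj₁ k) = inj₂ (next-functional ul k m)
at-most-two-neighbours ul x≢y (inj₂ n) (inj₁ m) (inj₂ k) = inj₁ (next-injective ul k n)

-- Membership spreads from `x` in both directions along the list. In the applications,
-- path-circularity closes `T` under adjacency.
path-connected : (T : A → Set) → (∀ {x y} → Adj l x y → T x → T y) → x ∈ l → T x → All T l
path-connected {l = _ ∷ []}    T step (here refl) Tx = Tx ∷ []
path-connected {l = _ ∷ _ ∷ _} T step (here refl) Tx =
  Tx ∷ path-connected T (step ∘ Sum.map there there) (here refl) (step (inj₁ here) Tx)
path-connected {l = _ ∷ _ ∷ _} T step (there x∈l) Tx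
  with path-connected T (step ∘ Sum.map there there) x∈l Tx
... | Ty ∷ Tl = step (inj₂ here) Ty ∷ Ty ∷ Tl

-- Positions

∈⇒at : x ∈ l → ∃ λ i → At l i x
∈⇒at (here refl) = _ , here
∈⇒at (there x∈l) = _ , there (proj₂ (∈⇒at x∈l))

at⇒∈ : At l i x → x ∈ l
at⇒∈ here      = here refl
at⇒∈ (there a) = there (at⇒∈ a)

at-functional : At l i x → At l i y → x ≡ y
at-functional here      here       = refl
at-functional (there a) (there a′) = at-functional a a′

at-injective : Unique l → At l i x → At l j x → i ≡ j
at-injective ul       here      here       = refl
at-injective ul       here      (there a)  = contradiction (at⇒∈ a) (head-∉ ul)
at-injective ul       (there a) here       = contradiction (at⇒∈ a) (head-∉ ul)
at-injective (_ ∷ ul) (there a) (there a′) = cong suc (at-injective ul a a′)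

at-≤ : i ≤ j → At l j x → ∃ λ y → At l i y
at-≤ {l = _ ∷ _} z≤n       a         = _ , here
at-≤             (s≤s i≤j) (there a) = _ , there (proj₂ (at-≤ i≤j a))

at? : DecidableEquality A → ∀ (l : List A) i x → Dec (At l i x)
at? _≟_ []      i       x = no λ ()
at? _≟_ (y ∷ l) zero    x = map′ (λ { refl → here }) (λ { here → refl }) (y ≟ x)
at? _≟_ (y ∷ l) (suc i) x = map′ there (λ { (there a) → a }) (at? _≟_ l i x)

at-length : At l i x → i < length l
at-length here      = s≤s z≤n
at-length (there a) = s≤s (at-length a)

at⇒next : At l i x → At l (suc i) y → Next x y l
at⇒next here      (there here) = here
at⇒next (there a) (there a′)   = there (at⇒next a a′)

next⇒at : Next x y l → ∃ λ i → At l i x × At l (suc i) y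
next⇒at here      = zero , here , there here
next⇒at (there n) with next⇒at n
... | i , a , a′ = suc i , there a , there a′

-- Adding a vertex at the end, and removing a vertex

next-∷ʳ⁺ : Next x y l → Next x y (l ∷ʳ b)
next-∷ʳ⁺ here      = here
next-∷ʳ⁺ (there n) = there (next-∷ʳ⁺ n)

last-next-∷ʳ : Last x l → Next x b (l ∷ʳ b)
last-next-∷ʳ here      = here
last-next-∷ʳ (there f) = there (last-next-∷ʳ f)

next-∷ʳ⁻ : ∀ l → Next x y (l ∷ʳ b) → Next x y l ⊎ (Last x l × y ≡ b)
next-∷ʳ⁻ []          (there ())
next-∷ʳ⁻ (w ∷ [])    here                = inj₂ (here , refl)
next-∷ʳ⁻ (w ∷ [])    (there (there ()))
next-∷ʳ⁻ (w ∷ _ ∷ _) here                = inj₁ here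
next-∷ʳ⁻ (w ∷ _ ∷ _) (there n) with next-∷ʳ⁻ _ n
... | inj₁ m       = inj₁ (there m)
... | inj₂ (f , e) = inj₂ (there f , e)

first-∷ʳ⁺ : First x l → First x (l ∷ʳ b)
first-∷ʳ⁺ here = here

last-∷ʳ : ∀ l → Last b (l ∷ʳ b)
last-∷ʳ []      = here
last-∷ʳ (_ ∷ l) = there (last-∷ʳ l)

last-functional : Last x l → Last y l → x ≡ y
last-functional here      here       = refl
last-functional (there f) (there f′) = last-functional f f′

∈⇒last : x ∈ l → ∃ λ y → Last y l
∈⇒last {l = _ ∷ []}    _ = _ , here
∈⇒last {l = _ ∷ _ ∷ _} _ = _ , there (proj₂ (∈⇒last (here refl)))

-- Only the first and the last vertex need testing. The decision makes the argument by contradiction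
-- in `ends-contract` constructive.
end-among? : DecidableEquality A → ∀ (p q : List A) → Dec (∃ λ t → End p t × t ∈ q)
end-among? _≟_ []        q = no λ { (_ , inj₁ () , _) ; (_ , inj₂ () , _) }
end-among? _≟_ p@(f ∷ _) q with ∈⇒last {l = p} (here refl)
... | g , last-g with DecMembership._∈?_ _≟_ f q | DecMembership._∈?_ _≟_ g q
...   | yes f∈q | _       = yes (f , inj₁ here , f∈q)
...   | no  _   | yes g∈q = yes (g , inj₂ last-g , g∈q)
...   | no  f∉q | no  g∉q = no λ
  { (_ , inj₁ here , t∈q)   → f∉q t∈q
  ; (_ , inj₂ last-t , t∈q) → g∉q (subst (_∈ q) (last-functional last-t last-g) t∈q) }

module Remove {A : Set} (_≟_ : DecidableEquality A) (z : A) where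

  private
    variable
      a a′ : A
      s : List A

  remove : List A → List A
  remove = filter (λ x → ¬? (x ≟ z))

  ∈-remove⁺ : a ∈ s → a ≢ z → a ∈ remove s
  ∈-remove⁺ = ∈-filter⁺ _

  ∈-remove⁻ : ∀ s → a ∈ remove s → a ∈ s × a ≢ z
  ∈-remove⁻ _ = ∈-filter⁻ _

  unique-remove : Unique s → Unique (remove s)
  unique-remove = Unique.filter⁺ _

  first-remove : First a s → a ≢ z → First a (remove s)
  first-remove {a} here a≢z with a ≟ z
  ... | yes a≡z = contradiction a≡z a≢z
  ... | no  _   = here

  last-remove : Last a s → a ≢ z → Last a (remove s)
  last-remove {a} here a≢z with a ≟ z
  ... | yes a≡z = contradiction a≡z a≢z
  ... | no  _   = here
  last-remove (there {w = w} f) a≢z with w ≟ z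
  ... | yes _ = last-remove f a≢z
  ... | no  _ = there (last-remove f a≢z)

  end-remove : End s a → a ≢ z → End (remove s) a
  end-remove (inj₁ f) a≢z = inj₁ (first-remove f a≢z)
  end-remove (inj₂ f) a≢z = inj₂ (last-remove f a≢z)

  next-remove⁺ : Next a a′ s → a ≢ z → a′ ≢ z → Next a a′ (remove s)
  next-remove⁺ {a} {a′} here a≢z a′≢z with a ≟ z
  ... | yes a≡z = contradiction a≡z a≢z
  ... | no  _ with a′ ≟ z
  ...   | yes a′≡z = contradiction a′≡z a′≢z
  ...   | no  _    = here
  next-remove⁺ (there {w = w} n) a≢z a′≢z with w ≟ z
  ... | yes _ = next-remove⁺ n a≢z a′≢z
  ... | no  _ = there (next-remove⁺ n a≢z a′≢z)

  next-remove-join : Unique s → Next a z s → Next z a′ s → Next a a′ (remove s)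
  next-remove-join um here here = contradiction (here refl) (head-∉ um)
  next-remove-join um (there n) here = contradiction (next-∈ʳ n) (head-∉ um)
  next-remove-join {a = a} um here (there here) with a ≟ z
  ... | yes refl = contradiction (here refl) (head-∉ um)
  ... | no  _ with z ≟ z
  ...   | no z≢z = contradiction refl z≢z
  next-remove-join {a′ = a′} um@(_ ∷ um′) here (there here) | no _ | yes _ with a′ ≟ z
  ...     | yes refl = contradiction (here refl) (head-∉ um′)
  ...     | no  _    = here
  next-remove-join (_ ∷ um) here (there (there n)) = contradiction (next-∈ˡ n) (head-∉ um)
  next-remove-join (_ ∷ um) (there {w = w} n) (there n′) with w ≟ z
  ... | yes _ = next-remove-join um n n′
  ... | no  _ = there (next-remove-join um n n′)

  first-remove-join : Unique s → First z s → Next z a s → First a (remove s)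
  first-remove-join um here (there n) = contradiction (next-∈ˡ n) (head-∉ um)
  first-remove-join {a = a} um here here with z ≟ z
  ... | no z≢z = contradiction refl z≢z
  ... | yes _ with a ≟ z
  ...   | yes refl = contradiction (here refl) (head-∉ um)
  ...   | no  _    = here

  last-remove-join : Unique s → Last z s → Next a z s → Last a (remove s)
  last-remove-join um (there (there f)) here = contradiction (last-∈ f) (head-∉ (tail um))
    where
    tail : ∀ {w l} → Unique (w ∷ l) → Unique l
    tail (_ ∷ ul) = ul
  last-remove-join {a = a} um (there here) here with a ≟ z
  ... | yes refl = contradiction (here refl) (head-∉ um)
  ... | no  _ with z ≟ z
  ...   | yes _  = here
  ...   | no z≢z = contradiction refl z≢z
  last-remove-join (_ ∷ um) (there {w = w} f) (there n) with w ≟ z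
  ... | yes _ = last-remove-join um f n
  ... | no  _ = there (last-remove-join um f n)
  last-remove-join um here (there ())

  -- `filter` drops at most one entry of a duplicate-free list, so a new first vertex can only be
  -- the former second one.
  first-remove⁻ : Unique s → First a (remove s) → First a s ⊎ (First z s × Next z a s)
  first-remove⁻ {s = w ∷ s} um@(_ ∷ um′) f with w ≟ z
  first-remove⁻ {s = w ∷ s} um@(_ ∷ um′) here | no _ = inj₁ here
  ... | yes refl with first-remove⁻ um′ f
  ...   | inj₁ here    = inj₂ (here , here)
  ...   | inj₂ (g , _) = contradiction (first-∈ g) (head-∉ um)

  next-remove⁻ : Unique s → Next a a′ (remove s) → Next a a′ s ⊎ (Next a z s × Next z a′ s)
  next-remove⁻ {s = w ∷ s} (_ ∷ um) n with w ≟ z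
  ... | yes _ = Sum.map there (λ (n , n′) → there n , there n′) (next-remove⁻ um n)
  ... | no  _ with next-∷⁻ n
  ...   | inj₁ n′ = Sum.map there (λ (n , n′) → there n , there n′) (next-remove⁻ um n′)
  ...   | inj₂ (refl , f) with first-remove⁻ um f
  ...     | inj₁ here       = inj₁ here
  ...     | inj₂ (here , n′) = inj₂ (here , there n′)

  adj-remove⁺ : ∀ {l u v} → Adj l u v → u ≢ z → v ≢ z → Adj (remove l) u v
  adj-remove⁺ (inj₁ n) u≢z v≢z = inj₁ (next-remove⁺ n u≢z v≢z)
  adj-remove⁺ (inj₂ n) u≢z v≢z = inj₂ (next-remove⁺ n v≢z u≢z)

  adj-remove-join : ∀ {l u v} → Unique l → u ≢ v → Adj l z u → Adj l z v → Adj (remove l) u v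
  adj-remove-join ul u≢v (inj₁ n) (inj₁ s) = contradiction (next-functional ul n s) u≢v
  adj-remove-join ul u≢v (inj₁ n) (inj₂ s) = inj₂ (next-remove-join ul s n)
  adj-remove-join ul u≢v (inj₂ n) (inj₁ s) = inj₁ (next-remove-join ul n s)
  adj-remove-join ul u≢v (inj₂ n) (inj₂ s) = contradiction (next-injective ul n s) u≢v

  adj-remove⁻ : ∀ {l u v} → Unique l → Adj (remove l) u v → Adj l u v ⊎ (Adj l z u × Adj l z v)
  adj-remove⁻ ul (inj₁ n) = Sum.map inj₁ (λ (n , s) → inj₂ n , inj₁ s) (next-remove⁻ ul n)
  adj-remove⁻ ul (inj₂ n) = Sum.map inj₂ (λ (n , s) → inj₁ s , inj₂ n) (next-remove⁻ ul n)

  end-remove-join : ∀ {l u} → Unique l → End l z → Adj l z u → End (remove l) u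
  end-remove-join ul (inj₁ f) (inj₁ n) = inj₁ (first-remove-join ul f n)
  end-remove-join ul (inj₁ f) (inj₂ n) = contradiction n (first-no-pred ul f)
  end-remove-join ul (inj₂ f) (inj₁ n) = contradiction n (last-no-succ ul f)
  end-remove-join ul (inj₂ f) (inj₂ n) = inj₂ (last-remove-join ul f n)

  interior-remove⁻ : ∀ {l u} → Unique l → Interior (remove l) u → Interior l u
  interior-remove⁻ ul ((_ , n) , (_ , s)) =
    [ (λ k → _ , k) , (λ (_ , k) → _ , k) ] (next-remove⁻ ul n) ,
    [ (λ k → _ , k) , (λ (k , _) → _ , k) ] (next-remove⁻ ul s)

-- Path-circular collections of lists

-- For an interior vertex u of p, "u has degree 2" says that the neighbours of u
-- on any path are its two neighbours on p.
record _▷_ {A : Set} (p q : List A) : Set where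
  field
    neighbours : ∀ {u v} → Interior p u → Adj q u v → Adj p u v
    ends       : ∀ {u} → u ∈ p → u ∈ q → ∃ λ t → End p t × t ∈ q

infix 4 _▷_

open _▷_

record PathCircular {I A : Set} (L : I → List A) : Set where
  field
    unique : ∀ i → Unique (L i)
    compat : ∀ i j → L i ▷ L j

-- Otherwise the vertices of q on e strictly after x and up to c are closed under
-- adjacency on q, so they are all of q, which then contains no end of e.
initial-segment : ∀ {A : Set} (_≟_ : DecidableEquality A) {e q : List A} {b c x i j} →
                  Unique e → e ▷ q → At e i c → At e (suc i) b → c ∈ q → b ∉ q →
                  j ≤ i → At e j x → x ∈ q
initial-segment _≟_ {e} {q} {b} {c} {x} {i} {j} ue e▷q ac ab c∈q b∉q j≤i ax
  with DecMembership._∈?_ _≟_ x q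
... | yes x∈q = x∈q
... | no  x∉q = contradiction (All.lookup all-T t∈q) t∉T
  where
  T : _ → Set
  T y = y ∈ q × ∃ λ k → j < k × k ≤ i × At e k y

  interior-T : ∀ {k y} → j < k → k ≤ i → At e k y → Interior e y
  interior-T (s≤s _) k≤i ay =
    (_ , at⇒next (proj₂ (at-≤ (ℕ.n≤1+n _) ay)) ay) , (_ , at⇒next ay (proj₂ (at-≤ (s≤s k≤i) ab)))

  step : ∀ {y v} → Adj q y v → T y → T v
  step {y} {v} adj (y∈q , k , j<k , k≤i , ay) with neighbours e▷q (interior-T j<k k≤i ay) adj
  ... | inj₁ n with k′ , ay′ , av ← next⇒at n with refl ← at-injective ue ay ay′ =
    adj-∈ʳ adj , suc k , ℕ.m≤n⇒m≤1+n j<k , ℕ.≤∧≢⇒< k≤i k≢i , av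
    where
    k≢i : k ≢ i
    k≢i refl = b∉q (subst (_∈ q) (at-functional av ab) (adj-∈ʳ adj))
  ... | inj₂ n with k′ , av , ay′ ← next⇒at n with refl ← at-injective ue ay ay′ =
    adj-∈ʳ adj , k′ , ℕ.≤∧≢⇒< (s≤s⁻¹ j<k) j≢k′ , ℕ.<⇒≤ k≤i , av
    where
    j≢k′ : j ≢ k′
    j≢k′ refl = x∉q (subst (_∈ q) (at-functional av ax) (adj-∈ʳ adj))

  all-T : All T q
  all-T = path-connected T step c∈q (c∈q , i , ℕ.≤∧≢⇒< j≤i j≢i , ℕ.≤-refl , ac)
    where
    j≢i : j ≢ i
    j≢i refl = x∉q (subst (_∈ q) (at-functional ac ax) c∈q)

  end = ends e▷q (at⇒∈ ac) c∈q
  t∈q = proj₂ (proj₂ end)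

  t∉T : ¬ T (proj₁ end)
  t∉T (_ , k , j<k , k≤i , at) = interior-¬end ue (interior-T j<k k≤i at) (proj₁ (proj₂ end))

-- Extending a path by the vertex after its initial segment of `e`

module Extend {A : Set} (_≟_ : DecidableEquality A) (e : List A) (ue : Unique e) where

  open DecMembership _≟_ using (_∈?_)

  -- The place where `q` leaves `e`, read in the direction of `e`: contraction adds `b` to `q` next
  -- to `c`.
  record Jump (q : List A) (c b : A) : Set where
    constructor jump
    field
      next : Next c b e
      c∈q  : c ∈ q
      b∉q  : b ∉ q

  -- By `initial-segment` at the later of two jumps, `q` contains everything on `e` before it,
  -- including the vertex that the earlier jump misses.
  jump-unique : ∀ {q c b c′ b′} → e ▷ q → Jump q c b → Jump q c′ b′ → c ≡ c′ × b ≡ b′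
  jump-unique e▷q (jump n c∈q b∉q) (jump n′ c′∈q b′∉q)
    with i , ac , ab ← next⇒at n | i′ , ac′ , ab′ ← next⇒at n′ with ℕ.<-cmp i i′
  ... | tri< i<i′ _ _ = contradiction (initial-segment _≟_ ue e▷q ac′ ab′ c′∈q b′∉q i<i′ ab) b∉q
  ... | tri≈ _ refl _ = at-functional ac ac′ , at-functional ab ab′
  ... | tri> _ _ i′<i = contradiction (initial-segment _≟_ ue e▷q ac ab c∈q b∉q i′<i ab′) b′∉q

  jump? : ∀ q → Dec (∃₂ (Jump q))
  jump? q = map′ (λ (c , b , n , c∈q , b∉q) → c , b , jump n c∈q b∉q)
                 (λ (c , b , jump n c∈q b∉q) → c , b , n , c∈q , b∉q) (search e)
    where
    search : ∀ l → Dec (∃₂ λ c b → Next c b l × c ∈ q × b ∉ q)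
    search []          = no λ ()
    search (c ∷ [])    = no λ { (_ , _ , there () , _) }
    search (c ∷ b ∷ l) with (c ∈? q) ×-dec ¬? (b ∈? q) | search (b ∷ l)
    ... | yes (c∈q , b∉q) | _                     = yes (c , b , here , c∈q , b∉q)
    ... | no  _           | yes (c′ , b′ , n , r) = yes (c′ , b′ , there n , r)
    ... | no  ¬here       | no ¬there             = no λ
      { (_ , _ , here    , r) → ¬here r
      ; (_ , _ , there n , r) → ¬there (_ , _ , n , r) }

  -- If `c` were interior to `q`, then its neighbour `b` on `e` would be a neighbour on `q` and so
  -- lie on `q`.
  jump-end : ∀ {q c b} → q ▷ e → Jump q c b → End q c
  jump-end q▷e (jump n c∈q b∉q) with end-or-interior c∈q
  ... | inj₁ end = end
  ... | inj₂ int = contradiction (adj-∈ʳ (neighbours q▷e int (inj₁ n))) b∉q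

  -- Describes `q` with `b` attached to `c`, or `q` itself if there is no jump. Stating this by
  -- properties hides whether `b` was put in front or behind.
  record Extension (q q⁺ : List A) : Set where
    field
      unique⁺  : Unique q⁺
      ⊆⁺       : ∀ {x} → x ∈ q → x ∈ q⁺
      ∈⁻       : ∀ {x} → x ∈ q⁺ → x ∈ q ⊎ ∃ λ c → Jump q c x
      adj⁺     : ∀ {x y} → Adj q x y → Adj q⁺ x y
      adj⁻     : ∀ {x y} → Adj q⁺ x y → Adj q x y ⊎ Jump q x y ⊎ Jump q y x
      end⁺     : ∀ {x} → End q x → End q⁺ x ⊎ ∃ λ b → Jump q x b
      jump-end⁺ : ∀ {c b} → Jump q c b → End q⁺ b
      jump-adj⁺ : ∀ {c b} → Jump q c b → Adj q⁺ c b

    -- The added vertex is an end, and an old end can only become interior if the new vertex was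
    -- attached to it.
    interior⁻ : Unique q → ∀ {x} → Interior q⁺ x → Interior q x ⊎ ∃ λ b → Jump q x b
    interior⁻ uq int with ∈⁻ (interior-∈ int)
    ... | inj₂ (_ , J) = contradiction (jump-end⁺ J) (interior-¬end unique⁺ int)
    ... | inj₁ x∈q with end-or-interior x∈q
    ...   | inj₂ int′ = inj₁ int′
    ...   | inj₁ end with end⁺ end
    ...     | inj₁ end′ = contradiction end′ (interior-¬end unique⁺ int)
    ...     | inj₂ J    = inj₂ J

    next-∈⁺ : ∀ {c b} → Next c b e → c ∈ q → b ∈ q⁺
    next-∈⁺ {c} {b} n c∈q with b ∈? q
    ... | yes b∈q = ⊆⁺ b∈q
    ... | no  b∉q = end-∈ (jump-end⁺ (jump n c∈q b∉q))

  open Extension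

  -- By `jump-end` there is room for `b` in front of or behind `c`; by `jump-unique` this one
  -- addition serves every jump of `q`.
  extend : ∀ q → Unique q → e ▷ q → q ▷ e → ∃ (Extension q)
  extend q uq e▷q q▷e with jump? q
  ... | no ¬J = q , record
    { unique⁺   = uq
    ; ⊆⁺        = id
    ; ∈⁻        = inj₁
    ; adj⁺      = id
    ; adj⁻      = inj₁
    ; end⁺      = inj₁
    ; jump-end⁺ = λ J → contradiction (_ , _ , J) ¬J
    ; jump-adj⁺ = λ J → contradiction (_ , _ , J) ¬J
    }
  ... | yes (c , b , J) with jump-end q▷e J
  ...   | inj₁ here = b ∷ q , record
    { unique⁺   = unique-∷ (Jump.b∉q J) uq
    ; ⊆⁺        = there
    ; ∈⁻        = λ { (here refl) → inj₂ (c , J) ; (there x∈q) → inj₁ x∈q }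
    ; adj⁺      = Sum.map there there
    ; adj⁻      = λ { (inj₁ here)      → inj₂ (inj₂ J)
                    ; (inj₁ (there n)) → inj₁ (inj₁ n)
                    ; (inj₂ here)      → inj₂ (inj₁ J)
                    ; (inj₂ (there n)) → inj₁ (inj₂ n) }
    ; end⁺      = λ { (inj₁ here) → inj₂ (b , J) ; (inj₂ f) → inj₁ (inj₂ (there f)) }
    ; jump-end⁺ = λ J′ → case jump-unique e▷q J J′ of λ { (refl , refl) → inj₁ here }
    ; jump-adj⁺ = λ J′ → case jump-unique e▷q J J′ of λ { (refl , refl) → inj₂ here }
    }
  ...   | inj₂ last = q ∷ʳ b , record
    { unique⁺   = unique-∷ʳ uq (Jump.b∉q J)
    ; ⊆⁺        = ∈-++⁺ˡ
    ; ∈⁻        = λ x∈ → case ∈-++⁻ q x∈ of λ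
                  { (inj₁ x∈q) → inj₁ x∈q ; (inj₂ (here refl)) → inj₂ (c , J) }
    ; adj⁺      = Sum.map next-∷ʳ⁺ next-∷ʳ⁺
    ; adj⁻      = λ { (inj₁ n) → Sum.map inj₁ inj₁ (new n)
                    ; (inj₂ n) → Sum.map inj₂ inj₂ (new n) }
    ; end⁺      = λ { (inj₁ f) → inj₁ (inj₁ (first-∷ʳ⁺ f))
                    ; (inj₂ f) → case last-functional last f of λ { refl → inj₂ (b , J) } }
    ; jump-end⁺ = λ J′ → case jump-unique e▷q J J′ of λ { (refl , refl) → inj₂ (last-∷ʳ q) }
    ; jump-adj⁺ = λ J′ → case jump-unique e▷q J J′ of λ { (refl , refl) → inj₁ (last-next-∷ʳ last) }
    }
    where
    new : ∀ {x y} → Next x y (q ∷ʳ b) → Next x y q ⊎ Jump q x y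
    new n with next-∷ʳ⁻ q n
    ... | inj₁ m          = inj₁ m
    ... | inj₂ (f , refl) with refl ← last-functional last f = inj₂ J

-- Path-circularity of the contracted collection

module Contract {A : Set} (_≟_ : DecidableEquality A) (z : A) (as : List A)
                (ue : Unique (z ∷ as)) where

  private
    e = z ∷ as

  open Extend _≟_ e ue public
  open Extension
  open Remove _≟_ z public

  adj⁻ₑ : ∀ {q q⁺ u v} → Extension q q⁺ → Adj q⁺ u v → Adj q u v ⊎ Adj e u v
  adj⁻ₑ X adj = Sum.map id [ inj₁ ∘ Jump.next , inj₂ ∘ Jump.next ] (adj⁻ X adj)

  jump-interior : ∀ {q c b} → Jump q c b → c ≢ z → Interior e c
  jump-interior (jump n _ _) c≢z with first-or-pred (next-∈ˡ n)
  ... | inj₁ here = contradiction refl c≢z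
  ... | inj₂ pred = pred , (_ , n)

  module _ {p q p⁺ q⁺ : List A} (P : Extension p p⁺) (Q : Extension q q⁺)
           (up : Unique p) (uq : Unique q)
           (p▷q : p ▷ q) (p▷e : p ▷ e) (e▷p : e ▷ p) (q▷e : q ▷ e) (e▷q : e ▷ q) where

    -- All edges of `q⁺` come from `q` or `e`, which settles the case of `u` interior to `p`.
    -- Otherwise `u` is where `p` was extended. Being different from `z`, it is interior to `e`, so
    -- its neighbours on `p⁺` and on `q⁺` are all among its two neighbours on `e`, and `p⁺` already
    -- has both.
    neighbours⁺ : ∀ {u v} → u ≢ z → Interior p⁺ u → Adj q⁺ u v → Adj p⁺ u v
    neighbours⁺ {u} {v} u≢z int adj with interior⁻ P up int
    ... | inj₁ int′ = adj⁺ P ([ neighbours p▷q int′ , neighbours p▷e int′ ] (adj⁻ₑ Q adj))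
    ... | inj₂ (_ , J) with interior-neighbours (unique⁺ P) int
    ...   | x , y , x≢y , ux , uy
      with at-most-two-neighbours ue x≢y (onₑ e▷p P ux) (onₑ e▷p P uy) (onₑ e▷q Q adj)
      where
      onₑ : ∀ {q q⁺ v} → e ▷ q → Extension q q⁺ → Adj q⁺ u v → Adj e u v
      onₑ e▷q Q = [ neighbours e▷q (jump-interior J u≢z) , id ] ∘ adj⁻ₑ Q
    ...     | inj₁ refl = ux
    ...     | inj₂ refl = uy

    -- An end `t` of `p` on `q` stops being an end only if `p` was extended at `t` by its successor
    -- on `e`; that successor is then an end of `p⁺`, and it lies on `q⁺` because `t` lies on `q`.
    meet⇒end⁺ : ∀ {w} → w ∈ p → w ∈ q → ∃ λ t → End p⁺ t × t ∈ q⁺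
    meet⇒end⁺ w∈p w∈q with ends p▷q w∈p w∈q
    ... | t , end , t∈q with end⁺ P end
    ...   | inj₁ end′    = t , end′ , ⊆⁺ Q t∈q
    ...   | inj₂ (b , J) = b , jump-end⁺ P J , next-∈⁺ Q (Jump.next J) t∈q

    ends⁺ : ∀ {u} → u ≢ z → u ∈ p⁺ → u ∈ q⁺ → ∃ λ t → End p⁺ t × t ∈ q⁺
    ends⁺ {u} u≢z u∈p⁺ u∈q⁺ with end-or-interior u∈p⁺
    ... | inj₁ end = u , end , u∈q⁺
    ... | inj₂ int with ∈⁻ Q u∈q⁺ | interior⁻ P up int
    ...   | inj₁ u∈q | inj₁ int′          = meet⇒end⁺ (interior-∈ int′) u∈q
    ...   | inj₁ u∈q | inj₂ (_ , J)       = meet⇒end⁺ (Jump.c∈q J) u∈q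
    -- Here `u` was added to `q` after `c`. As `u` is interior to `p`, its neighbour `c` on `e` is
    -- also on `p`, so `p` and `q` meet in `c`.
    ...   | inj₂ (c , jump n c∈q _) | inj₁ int′ =
      meet⇒end⁺ (adj-∈ʳ (neighbours p▷e int′ (inj₂ n))) c∈q
    -- Here `p` leaves `e` right after `u`, so it contains the initial segment of `e` up to `u`, and
    -- with it the predecessor `c`.
    ...   | inj₂ (c , jump n c∈q _) | inj₂ (_ , jump n′ u∈p b∉p)
      with i , ac , au ← next⇒at n | i′ , au′ , ab ← next⇒at n′
      with refl ← at-injective ue au au′ =
      meet⇒end⁺ (initial-segment _≟_ ue e▷p au ab u∈p b∉p (ℕ.n≤1+n i) ac) c∈q

    -- The case that `neighbours⁺` leaves out. If `z` is not interior to `p`, then `p` was extended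
    -- at `z` by the second vertex `b` of `e`, and `b` differs from `u`, being an end of `p⁺`.
    through-z⁺ : ∀ {u v} → Interior p⁺ u → Interior p⁺ z → Adj q⁺ z u → Adj q⁺ z v →
                 u ≢ v → Adj p⁺ z v
    through-z⁺ {u} {v} intu intz zu zv u≢v with interior⁻ P up intz
    ... | inj₁ int = adj⁺ P ([ neighbours p▷q int , neighbours p▷e int ] (adj⁻ₑ Q zv))
    ... | inj₂ (b , J) with b ≟ v
    ...   | yes refl = jump-adj⁺ P J
    -- A jump at `z` could only add `b`, so the edges from `z` to `u` and `v` already belong to `q`.
    -- Then `z` is interior to `q` and its neighbour `b` on `e` would be a third neighbour on `q`.
    ...   | no b≢v = contradiction (neighbours q▷e z-int (inj₁ (Jump.next J))) ¬zb
      where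
      b≢u : b ≢ u
      b≢u refl = interior-¬end (unique⁺ P) intu (jump-end⁺ P J)

      old : ∀ {w} → b ≢ w → Adj q⁺ z w → Adj q z w
      old b≢w zw with adj⁻ Q zw
      ... | inj₁ zw′        = zw′
      ... | inj₂ (inj₁ J′)  = contradiction (next-functional ue (Jump.next J) (Jump.next J′)) b≢w
      ... | inj₂ (inj₂ J′)  = contradiction (Jump.next J′) (first-no-pred ue here)

      z-int : Interior q z
      z-int = neighbours-interior uq u≢v (old b≢u zu) (old b≢v zv)

      ¬zb : ¬ Adj q z b
      ¬zb zb = [ b≢u , b≢v ] (at-most-two-neighbours uq u≢v (old b≢u zu) (old b≢v zv) zb)

    private
      r⁺ = remove p⁺
      s⁺ = remove q⁺

    neighbours-contract : ∀ {u v} → Interior r⁺ u → Adj s⁺ u v → Adj r⁺ u v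
    neighbours-contract {u} {v} int adj with adj-remove⁻ (unique⁺ Q) adj
    ... | inj₁ uv = adj-remove⁺ (neighbours⁺ u≢z (interior-remove⁻ (unique⁺ P) int) uv) u≢z v≢z
      where
      u≢z = proj₂ (∈-remove⁻ p⁺ (interior-∈ int))
      v≢z = proj₂ (∈-remove⁻ q⁺ (adj-∈ʳ adj))
    -- The edge arose by closing the gap at `z`. On `p⁺` the vertex `z` is next to `u`; it is no end
    -- of `p⁺`, since its removal would make `u` an end. Hence the same gap is closed on `p⁺`.
    ... | inj₂ (zu , zv) = join (end-or-interior (adj-∈ˡ zu⁺))
      where
      int⁺ = interior-remove⁻ (unique⁺ P) int
      zu⁺  = adj-sym (neighbours⁺ (proj₂ (∈-remove⁻ p⁺ (interior-∈ int))) int⁺ (adj-sym zu))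

      u≢v : u ≢ v
      u≢v refl = adj-irrefl (unique-remove (unique⁺ Q)) adj

      join : End p⁺ z ⊎ Interior p⁺ z → Adj r⁺ u v
      join (inj₁ end)  = contradiction (end-remove-join (unique⁺ P) end zu⁺)
                           (interior-¬end (unique-remove (unique⁺ P)) int)
      join (inj₂ intz) =
        adj-remove-join (unique⁺ P) u≢v zu⁺ (through-z⁺ int⁺ intz zu zv u≢v)

    -- If z is the only end of p⁺ on q⁺ and no end of p⁺ - z is on q⁺, then p⁺ - z
    -- contains every neighbour on q⁺ of each of its vertices, but not z itself.
    ends-contract : ∀ {u} → u ∈ r⁺ → u ∈ s⁺ → ∃ λ t → End r⁺ t × t ∈ s⁺
    ends-contract {u} u∈r⁺ u∈s⁺
      with u∈p⁺ , u≢z ← ∈-remove⁻ p⁺ u∈r⁺ | u∈q⁺ , _ ← ∈-remove⁻ q⁺ u∈s⁺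
      with ends⁺ u≢z u∈p⁺ u∈q⁺
    ... | t , end , t∈q⁺ with t ≟ z
    ...   | no t≢z = t , end-remove end t≢z , ∈-remove⁺ t∈q⁺ t≢z
    ...   | yes refl with end-among? _≟_ r⁺ s⁺
    ...     | yes found = found
    ...     | no ¬found = contradiction refl
                (proj₂ (∈-remove⁻ p⁺ (All.lookup (path-connected (_∈ r⁺) step u∈q⁺ u∈r⁺) t∈q⁺)))
      where
      step : ∀ {x y} → Adj q⁺ x y → x ∈ r⁺ → y ∈ r⁺
      step {x} {y} xy x∈r⁺ with end-or-interior x∈r⁺ | ∈-remove⁻ p⁺ x∈r⁺
      ... | inj₁ end-x | _ , x≢z = contradiction (x , end-x , ∈-remove⁺ (adj-∈ˡ xy) x≢z) ¬found
      ... | inj₂ int | _ , x≢z = ∈-remove⁺ (adj-∈ʳ xy⁺) y≢z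
        where
        xy⁺ = neighbours⁺ x≢z (interior-remove⁻ (unique⁺ P) int) xy

        y≢z : y ≢ z
        y≢z refl = interior-¬end (unique-remove (unique⁺ P)) int
                     (end-remove-join (unique⁺ P) end (adj-sym xy⁺))

    contract-▷ : r⁺ ▷ s⁺
    contract-▷ = record { neighbours = neighbours-contract ; ends = ends-contract }

_∈?_ : ∀ (v : Fin r) l → Dec (v ∈ l)
_∈?_ = DecMembership._∈?_ _≟_

-- Matchings

∈-tabulate⁺ : ∀ {P : Fin n → Set} (P? : ∀ x → Dec (P x)) {x} → P x → x ∈ˢ Vec.tabulate (does ∘ P?)
∈-tabulate⁺ P? {x} Px = lookup⇒[]= x _ (trans (lookup∘tabulate _ x) (dec-true (P? x) Px))

∈-tabulate⁻ : ∀ {P : Fin n → Set} (P? : ∀ x → Dec (P x)) {x} → x ∈ˢ Vec.tabulate (does ∘ P?) → P x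
∈-tabulate⁻ P? {x} x∈ with P? x in eq
... | yes Px = Px
... | no  _  with () ← trans (sym ([]=⇒lookup x∈)) (trans (lookup∘tabulate _ x) (cong does eq))

stars : (Fin n → List (Fin r)) → Fin r → Subset n
stars L v = Vec.tabulate (λ i → does (v ∈? L i))

∈-stars⁺ : ∀ (L : Fin n → List (Fin r)) {i v} → v ∈ L i → i ∈ˢ stars L v
∈-stars⁺ L {v = v} = ∈-tabulate⁺ (λ i → v ∈? L i)

∈-stars⁻ : ∀ (L : Fin n → List (Fin r)) {i v} → i ∈ˢ stars L v → v ∈ L i
∈-stars⁻ L {v = v} = ∈-tabulate⁻ (λ i → v ∈? L i)

-- A system of distinct representatives as a total function, constrained only on `X`, so that a
-- single value can be changed without carrying membership proofs.
record SDR (L : Fin n → List (Fin r)) (X : Subset n) : Set where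
  field
    rep           : Fin n → Fin r
    rep-∈         : ∀ {x} → x ∈ˢ X → rep x ∈ L x
    rep-injective : ∀ {x y} → x ∈ˢ X → y ∈ˢ X → rep x ≡ rep y → x ≡ y

open SDR

sdr⇒matching : ∀ {L : Fin n → List (Fin r)} {X} → SDR L X → Matching (stars L) X
sdr⇒matching {L = L} s = record
  { match     = λ x _ → rep s x
  ; match-∈   = λ x p → ∈-stars⁺ L (rep-∈ s p)
  ; injective = rep-injective s
  }

-- Outside `X` any value will do; `default` supplies one.
matching⇒sdr : ∀ (L : Fin n → List (Fin r)) {X} → Fin r → Matching (stars L) X → SDR L X
matching⇒sdr L {X} default k = record
  { rep           = f
  ; rep-∈         = λ {x} p → subst (_∈ L x) (sym (f≡ x p)) (∈-stars⁻ L (Matching.match-∈ k x p))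
  ; rep-injective = λ {x} {y} p q eq →
      Matching.injective k p q (trans (sym (f≡ x p)) (trans eq (f≡ y q)))
  }
  where
  f : _ → _
  f x with x ∈ˢ? X
  ... | yes p = Matching.match k x p
  ... | no  _ = default

  f≡ : ∀ x p → f x ≡ Matching.match k x p
  f≡ x p with x ∈ˢ? X
  ... | yes q   = cong (Matching.match k x) ([]=-irrelevant q p)
  ... | no  x∉X = contradiction p x∉X

matching-comap : ∀ {N : Fin r → Subset n} {N′ : Fin r → Subset m} {X X′}
                 (h : ∀ x → x ∈ˢ X′ → Fin n) → (∀ x p → h x p ∈ˢ X) →
                 (∀ {x y} p q → h x p ≡ h y q → x ≡ y) →
                 (∀ x p v → h x p ∈ˢ N v → x ∈ˢ N′ v) →
                 Matching N X → Matching N′ X′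
matching-comap h h-∈ h-inj h-N k = record
  { match     = λ x p → Matching.match k (h x p) (h-∈ x p)
  ; match-∈   = λ x p → h-N x p _ (Matching.match-∈ k (h x p) (h-∈ x p))
  ; injective = λ p q eq → h-inj p q (Matching.injective k (h-∈ _ p) (h-∈ _ q) eq)
  }

punch-view : ∀ (e x : Fin (suc n)) → x ≡ e ⊎ ∃ λ y → x ≡ punchIn e y
punch-view e x with e ≟ x
... | yes e≡x = inj₁ (sym e≡x)
... | no  e≢x = inj₂ (punchOut e≢x , sym (punchIn-punchOut e≢x))

∈-insertAt : ∀ (X : Subset n) e → e ∈ˢ insertAt X e inside
∈-insertAt X e = lookup⇒[]= e _ (insertAt-lookup X e inside)

∉-insertAt : ∀ (X : Subset n) e → ¬ e ∈ˢ insertAt X e outside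
∉-insertAt X e p with () ← trans (sym ([]=⇒lookup p)) (insertAt-lookup X e outside)

punchIn-∈⁺ : ∀ (X : Subset n) e b {x} → x ∈ˢ X → punchIn e x ∈ˢ insertAt X e b
punchIn-∈⁺ X e b {x} p = lookup⇒[]= _ _ (trans (insertAt-punchIn X e b x) ([]=⇒lookup p))

punchIn-∈⁻ : ∀ (X : Subset n) e b {x} → punchIn e x ∈ˢ insertAt X e b → x ∈ˢ X
punchIn-∈⁻ X e b {x} p = lookup⇒[]= _ _ (trans (sym (insertAt-punchIn X e b x)) ([]=⇒lookup p))

delete-matching : ∀ (L : Fin (suc n) → List (Fin r)) e X →
                  Matching (stars L) (insertAt X e outside) ⇔ Matching (stars (L ∘ punchIn e)) X
delete-matching L e X = mk⇔
  (matching-comap (λ x _ → punchIn e x) (λ x → punchIn-∈⁺ X e outside)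
    (λ {x} {y} _ _ → punchIn-injective e x y) (λ x _ v p → ∈-stars⁺ (L ∘ punchIn e) (∈-stars⁻ L p)))
  (matching-comap (λ x p → proj₁ (h x p)) (λ x p → proj₂ (proj₂ (h x p)))
    (λ {x} {y} p q eq → trans (h≡ x p) (trans (cong (punchIn e) eq) (sym (h≡ y q))))
    (λ x p v m → ∈-stars⁺ L (subst (λ y → v ∈ L y) (sym (h≡ x p)) (∈-stars⁻ (L ∘ punchIn e) m))))
  where
  h : ∀ x → x ∈ˢ insertAt X e outside → ∃ λ y → x ≡ punchIn e y × y ∈ˢ X
  h x p with punch-view e x
  ... | inj₁ refl       = contradiction p (∉-insertAt X e)
  ... | inj₂ (y , refl) = y , refl , punchIn-∈⁻ X e outside p

  h≡ : ∀ x p → x ≡ punchIn e (proj₁ (h x p))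
  h≡ x p = proj₁ (proj₂ (h x p))

-- Moving representatives along the contracted path

module Move {X : Subset n} (f : Fin n → Fin r) (hole : Fin r)
            (avoids : ∀ {x} → x ∈ˢ X → f x ≢ hole)
            (f-inj : ∀ {x y} → x ∈ˢ X → y ∈ˢ X → f x ≡ f y → x ≡ y)
            {a : Fin n} (a∈X : a ∈ˢ X) where

  moved : Fin n → Fin r
  moved = updateAt f a (const hole)

  moved-new : moved a ≡ hole
  moved-new = updateAt-updates a f

  moved-old : ∀ {x} → x ≢ a → moved x ≡ f x
  moved-old {x} = updateAt-minimal x a f

  -- By injectivity `a` alone was represented by `f a`, so this vertex is free after the move and
  -- serves as the next hole.
  moved-avoids : ∀ {x} → x ∈ˢ X → moved x ≢ f a
  moved-avoids {x} p with x ≟ a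
  ... | yes refl = λ eq → avoids a∈X (trans (sym eq) moved-new)
  ... | no  x≢a  = λ eq → x≢a (f-inj p a∈X (trans (sym (moved-old x≢a)) eq))

  moved-injective : ∀ {x y} → x ∈ˢ X → y ∈ˢ X → moved x ≡ moved y → x ≡ y
  moved-injective {x} {y} p q with x ≟ a | y ≟ a
  ... | yes refl | yes refl = λ _ → refl
  ... | yes refl | no  y≢a  = λ eq →
    contradiction (trans (sym (moved-old y≢a)) (trans (sym eq) moved-new)) (avoids q)
  ... | no  x≢a  | yes refl = λ eq →
    contradiction (trans (sym (moved-old x≢a)) (trans eq moved-new)) (avoids p)
  ... | no  x≢a  | no  y≢a  = λ eq →
    f-inj p q (trans (sym (moved-old x≢a)) (trans eq (moved-old y≢a)))

module Slide (e : List (Fin r)) (ue : Unique e) (q : Fin n → List (Fin r))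
             (e▷q : ∀ i → e ▷ q i) (X : Subset n) where

  -- An assignment missing the k-th vertex of e; a representative of x off q x is
  -- the successor in e of a vertex of q x, of position at least t.
  record Holed (k t : ℕ) : Set where
    field
      f       : Fin n → Fin r
      hole    : Fin r
      at-hole : At e k hole
      avoids  : ∀ {x} → x ∈ˢ X → f x ≢ hole
      f-inj   : ∀ {x y} → x ∈ˢ X → y ∈ˢ X → f x ≡ f y → x ≡ y
      fits    : ∀ {x} → x ∈ˢ X → f x ∈ q x ⊎
                ∃₂ λ j c → t ≤ j × At e j c × At e (suc j) (f x) × c ∈ q x

  open Holed

  -- The hole takes one step towards the front each time: whatever is represented by the predecessor
  -- of the hole moves into the hole, its own path containing that predecessor.
  slide-down : ∀ k → Holed k k → Holed zero zero
  slide-down zero    H = H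
  slide-down (suc k) H with c , at-c ← at-≤ (ℕ.n≤1+n k) (at-hole H)
    with any? (λ x → (x ∈ˢ? X) ×-dec (f H x ≟ c))
  ... | no none = slide-down k record
    { f       = f H
    ; hole    = c
    ; at-hole = at-c
    ; avoids  = λ x∈X fx≡c → none (_ , x∈X , fx≡c)
    ; f-inj   = f-inj H
    ; fits    = λ x∈X → Sum.map id (λ (j , c′ , k<j , r) → j , c′ , ℕ.<⇒≤ k<j , r) (fits H x∈X)
    }
  ... | yes (a , a∈X , refl) = slide-down k record
    { f       = moved
    ; hole    = f H a
    ; at-hole = at-c
    ; avoids  = moved-avoids
    ; f-inj   = moved-injective
    ; fits    = fits′
    }
    where
    open Move (f H) (hole H) (avoids H) (f-inj H) a∈X

    -- `a` is represented at position `k`, while representatives off their paths sit at position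
    -- `k + 2` or later.
    fa∈qa : f H a ∈ q a
    fa∈qa with fits H a∈X
    ... | inj₁ fa∈ = fa∈
    ... | inj₂ (j , _ , k<j , _ , at-fa , _) =
      contradiction (at-injective ue at-c at-fa) (ℕ.<⇒≢ (ℕ.m≤n⇒m≤1+n k<j))

    fits′ : ∀ {x} → x ∈ˢ X → moved x ∈ q x ⊎
            ∃₂ λ j c → k ≤ j × At e j c × At e (suc j) (moved x) × c ∈ q x
    fits′ {x} x∈X with x ≟ a
    ... | yes refl =
      inj₂ (k , f H a , ℕ.≤-refl , at-c , subst (At e (suc k)) (sym moved-new) (at-hole H) , fa∈qa)
    ... | no  x≢a rewrite moved-old x≢a =
      Sum.map id (λ (j , c′ , k<j , r) → j , c′ , ℕ.<⇒≤ k<j , r) (fits H x∈X)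

  -- `t` scans the positions of `e`, and `d` bounds the number still to be scanned. The hole stays
  -- at or before `t`, and representatives off their paths sit strictly after `t`; once `t` reaches
  -- the length of `e` there are none.
  slide-up : ∀ d {k t} → length e ≤ t + d → k ≤ t → Holed k t → ∃ λ k → Holed k (length e)
  slide-up zero {k} {t} len k≤t H = k , record
    { f       = f H
    ; hole    = hole H
    ; at-hole = at-hole H
    ; avoids  = avoids H
    ; f-inj   = f-inj H
    ; fits    = λ x∈X → Sum.map id
        (λ (j , c , t≤j , r) → j , c , ℕ.≤-trans (subst (length e ≤_) (ℕ.+-identityʳ t) len) t≤j , r)
        (fits H x∈X)
    }
  slide-up (suc d) {k} {t} len k≤t H
    with any? (λ x → (x ∈ˢ? X) ×-dec (at? _≟_ e (suc t) (f H x) ×-dec ¬? (f H x ∈? q x)))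
  ... | no none = slide-up d (subst (length e ≤_) (ℕ.+-suc t d) len) (ℕ.m≤n⇒m≤1+n k≤t) record
    { f       = f H
    ; hole    = hole H
    ; at-hole = at-hole H
    ; avoids  = avoids H
    ; f-inj   = f-inj H
    ; fits    = fits′
    }
    where
    fits′ : ∀ {x} → x ∈ˢ X → f H x ∈ q x ⊎
            ∃₂ λ j c → suc t ≤ j × At e j c × At e (suc j) (f H x) × c ∈ q x
    fits′ {x} x∈X with f H x ∈? q x | fits H x∈X
    ... | yes fx∈ | _       = inj₁ fx∈
    ... | no  fx∉ | inj₁ fx∈ = contradiction fx∈ fx∉
    ... | no  fx∉ | inj₂ (j , c , t≤j , at-c , at-fx , c∈) =
      inj₂ (j , c , ℕ.≤∧≢⇒< t≤j (λ { refl → none (x , x∈X , at-fx , fx∉) }) , at-c , at-fx , c∈)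
  ... | yes (a , a∈X , at-fa , fa∉) =
    slide-up d (subst (length e ≤_) (ℕ.+-suc t d) len) ℕ.≤-refl record
    { f       = moved
    ; hole    = f H a
    ; at-hole = at-fa
    ; avoids  = moved-avoids
    ; f-inj   = moved-injective
    ; fits    = fits′
    }
    where
    open Move (f H) (hole H) (avoids H) (f-inj H) a∈X

    -- The path of `a` contains the predecessor of `f H a` but not `f H a` itself, hence all of `e`
    -- up to that predecessor, and the hole lies there.
    hole∈qa : hole H ∈ q a
    hole∈qa with fits H a∈X
    ... | inj₁ fa∈ = contradiction fa∈ fa∉
    ... | inj₂ (j , c , t≤j , at-c , at-fa′ , c∈) =
      initial-segment _≟_ ue (e▷q a) at-c at-fa′ c∈ fa∉ (ℕ.≤-trans k≤t t≤j) (at-hole H)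

    fits′ : ∀ {x} → x ∈ˢ X → moved x ∈ q x ⊎
            ∃₂ λ j c → suc t ≤ j × At e j c × At e (suc j) (moved x) × c ∈ q x
    fits′ {x} x∈X with x ≟ a
    ... | yes refl = inj₁ (subst (_∈ q a) (sym moved-new) hole∈qa)
    ... | no  x≢a rewrite moved-old x≢a with fits H x∈X
    ...   | inj₁ fx∈ = inj₁ fx∈
    ...   | inj₂ (j , c , t≤j , at-c , at-fx , c∈) =
      inj₂ (j , c , ℕ.≤∧≢⇒< t≤j t≢j , at-c , at-fx , c∈)
      where
      -- Position `t + 1` represented only `a`, which has moved away.
      t≢j : t ≢ j
      t≢j refl = x≢a (f-inj H x∈X a∈X (at-functional at-fx at-fa))

-- Forwards, the representative of `e` is the initial hole and slides down to `z`. Backwards, `z` is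
-- the initial hole, and the final hole becomes the representative of `e`.
contract-matching : ∀ (L : Fin (suc n) → List (Fin r)) e {z as} → L e ≡ z ∷ as →
                    PathCircular L → (L′ : Fin n → List (Fin r)) →
                    (∀ {i v} → v ∈ L′ i ⇔
                      (v ≢ z × (v ∈ L (punchIn e i) ⊎ ∃ λ c → Next c v (L e) × c ∈ L (punchIn e i)))) →
                    ∀ X → Matching (stars L) (insertAt X e inside) ⇔ Matching (stars L′) X
contract-matching {n = n} {r = r} L e {z} {as} Le≡ pc L′ L′⇔ X = mk⇔ to from
  where
  open PathCircular pc
  q = L ∘ punchIn e
  open Slide (L e) (unique e) q (λ i → compat e (punchIn e i)) X
  open Holed

  at-z : At (L e) zero z
  at-z = subst (λ l → At l zero z) (sym Le≡) here

  to : Matching (stars L) (insertAt X e inside) → Matching (stars L′) X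
  to k = sdr⇒matching record
    { rep           = f H
    ; rep-∈         = λ x∈X → Equivalence.from L′⇔
        ( (λ fx≡z → avoids H x∈X (trans fx≡z (at-functional at-z (at-hole H))))
        , Sum.map id (λ (j , c , _ , at-c , at-fx , c∈) → c , at⇒next at-c at-fx , c∈) (fits H x∈X))
    ; rep-injective = f-inj H
    }
    where
    s   = matching⇒sdr L z k
    pos = ∈⇒at (rep-∈ s (∈-insertAt X e))

    H : Holed zero zero
    H = slide-down (proj₁ pos) record
      { f       = rep s ∘ punchIn e
      ; hole    = rep s e
      ; at-hole = proj₂ pos
      ; avoids  = λ {x} x∈X eq → punchInᵢ≢i e x
                    (rep-injective s (punchIn-∈⁺ X e inside x∈X) (∈-insertAt X e) eq)
      ; f-inj   = λ {x} {y} x∈X y∈X eq → punchIn-injective e x y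
                    (rep-injective s (punchIn-∈⁺ X e inside x∈X) (punchIn-∈⁺ X e inside y∈X) eq)
      ; fits    = λ x∈X → inj₁ (rep-∈ s (punchIn-∈⁺ X e inside x∈X))
      }

  from : Matching (stars L′) X → Matching (stars L) (insertAt X e inside)
  from k = sdr⇒matching record { rep = g ; rep-∈ = g-∈ ; rep-injective = g-inj }
    where
    s = matching⇒sdr L′ z k

    fits₀ : ∀ {x} → x ∈ˢ X → rep s x ∈ q x ⊎
            ∃₂ λ j c → zero ≤ j × At (L e) j c × At (L e) (suc j) (rep s x) × c ∈ q x
    fits₀ x∈X with proj₂ (Equivalence.to L′⇔ (rep-∈ s x∈X))
    ... | inj₁ fx∈ = inj₁ fx∈
    ... | inj₂ (c , n , c∈) with j , at-c , at-fx ← next⇒at n =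
      inj₂ (j , c , z≤n , at-c , at-fx , c∈)

    H : Holed _ (length (L e))
    H = proj₂ (slide-up (length (L e)) ℕ.≤-refl z≤n record
      { f       = rep s
      ; hole    = z
      ; at-hole = at-z
      ; avoids  = λ x∈X → proj₁ (Equivalence.to L′⇔ (rep-∈ s x∈X))
      ; f-inj   = rep-injective s
      ; fits    = fits₀
      })

    g : Fin (suc n) → Fin r
    g = Vector.insertAt (f H) e (hole H)

    g-e : g e ≡ hole H
    g-e = VectorP.insertAt-lookup (f H) e (hole H)

    g-punchIn : ∀ x → g (punchIn e x) ≡ f H x
    g-punchIn = VectorP.insertAt-punchIn (f H) e (hole H)

    f-∈ : ∀ {x} → x ∈ˢ X → f H x ∈ q x
    f-∈ x∈X with fits H x∈X
    ... | inj₁ fx∈ = fx∈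
    -- The scan is complete, so a representative off its path would need a position beyond the end
    -- of `e`.
    ... | inj₂ (j , c , len≤j , at-c , _) = contradiction (at-length at-c) (ℕ.≤⇒≯ len≤j)

    g-∈ : ∀ {x} → x ∈ˢ insertAt X e inside → g x ∈ L x
    g-∈ {x} p with punch-view e x
    ... | inj₁ refl       = subst (_∈ L e) (sym g-e) (at⇒∈ (at-hole H))
    ... | inj₂ (y , refl) = subst (_∈ q y) (sym (g-punchIn y)) (f-∈ (punchIn-∈⁻ X e inside p))

    g-inj : ∀ {x y} → x ∈ˢ insertAt X e inside → y ∈ˢ insertAt X e inside → g x ≡ g y → x ≡ y
    g-inj {x} {y} p p′ eq with punch-view e x | punch-view e y
    ... | inj₁ refl       | inj₁ refl       = refl
    ... | inj₁ refl       | inj₂ (y , refl) =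
      contradiction (trans (sym (g-punchIn y)) (trans (sym eq) g-e))
        (avoids H (punchIn-∈⁻ X e inside p′))
    ... | inj₂ (x , refl) | inj₁ refl       =
      contradiction (trans (sym (g-punchIn x)) (trans eq g-e))
        (avoids H (punchIn-∈⁻ X e inside p))
    ... | inj₂ (x , refl) | inj₂ (y , refl) = cong (punchIn e)
      (f-inj H (punchIn-∈⁻ X e inside p) (punchIn-∈⁻ X e inside p′)
        (trans (sym (g-punchIn x)) (trans eq (g-punchIn y))))

-- Graphs

module _ {P : Fin n → Set} (P? : ∀ x → Dec (P x)) {x y : Fin n}
         (x≢y : x ≢ y) (Px : P x) (Py : P y) where

  private
    S = Vec.tabulate (does ∘ P?)

  -- A third element would give an injection of a three-element set into `S`.
  ∣∣≡2⁻ : ∣ S ∣ ≡ 2 → ∀ {v} → P v → v ≡ x ⊎ v ≡ y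
  ∣∣≡2⁻ size {v} Pv with v ≟ x | v ≟ y
  ... | yes v≡x | _       = inj₁ v≡x
  ... | no  _   | yes v≡y = inj₂ v≡y
  ... | no  v≢x | no  v≢y = contradiction (subst (3 ≤_) size 3≤∣S∣) λ { (s≤s (s≤s ())) }
    where
    h : Fin 3 → Fin n
    h zero             = x
    h (suc zero)       = y
    h (suc (suc zero)) = v

    h-P : ∀ i → P (h i)
    h-P zero             = Px
    h-P (suc zero)       = Py
    h-P (suc (suc zero)) = Pv

    h-inj : ∀ i j → h i ≡ h j → i ≡ j
    h-inj zero             zero             _  = refl
    h-inj zero             (suc zero)       eq = contradiction eq x≢y
    h-inj zero             (suc (suc zero)) eq = contradiction (sym eq) v≢x
    h-inj (suc zero)       zero             eq = contradiction (sym eq) x≢y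
    h-inj (suc zero)       (suc zero)       _  = refl
    h-inj (suc zero)       (suc (suc zero)) eq = contradiction (sym eq) v≢y
    h-inj (suc (suc zero)) zero             eq = contradiction eq v≢x
    h-inj (suc (suc zero)) (suc zero)       eq = contradiction eq v≢y
    h-inj (suc (suc zero)) (suc (suc zero)) _  = refl

    3≤∣S∣ : 3 ≤ ∣ S ∣
    3≤∣S∣ = ∣∣-injective-≤ (⊤ {3}) S (λ i _ → h i) (λ i _ → ∈-tabulate⁺ P? (h-P i))
              (λ {i} {j} _ _ → h-inj i j)

  ∣∣≡2⁺ : (∀ {v} → P v → v ≡ x ⊎ v ≡ y) → ∣ S ∣ ≡ 2
  ∣∣≡2⁺ only = ℕ.≤-antisym
    (∣∣-injective-≤ S (⊤ {2}) (λ v p → h (only (∈-tabulate⁻ P? p))) (λ _ _ → ∈⊤)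
      (λ p q → h-inj (only (∈-tabulate⁻ P? p)) (only (∈-tabulate⁻ P? q))))
    (∣∣-injective-≤ (⊤ {2}) S (λ i _ → g i) (λ i _ → ∈-tabulate⁺ P? (g-P i))
      (λ {i} {j} _ _ → g-inj i j))
    where
    h : ∀ {v} → v ≡ x ⊎ v ≡ y → Fin 2
    h (inj₁ _) = zero
    h (inj₂ _) = suc zero

    h-inj : ∀ {v w} (s : v ≡ x ⊎ v ≡ y) (s′ : w ≡ x ⊎ w ≡ y) → h s ≡ h s′ → v ≡ w
    h-inj (inj₁ refl) (inj₁ refl) _ = refl
    h-inj (inj₂ refl) (inj₂ refl) _ = refl

    g : Fin 2 → Fin n
    g zero       = x
    g (suc zero) = y

    g-P : ∀ i → P (g i)
    g-P zero       = Px
    g-P (suc zero) = Py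

    g-inj : ∀ i j → g i ≡ g j → i ≡ j
    g-inj zero       zero       _  = refl
    g-inj zero       (suc zero) eq = contradiction eq x≢y
    g-inj (suc zero) zero       eq = contradiction (sym eq) x≢y
    g-inj (suc zero) (suc zero) _  = refl

linked⇒next : ∀ {A : Set} {R : Rel A 0ℓ} {l x y} → Linked R l → Next x y l → R x y
linked⇒next (Rxy ∷ _) here      = Rxy
linked⇒next (_ ∷ Rl)  (there n) = linked⇒next Rl n

next⇒linked : ∀ {A : Set} {R : Rel A 0ℓ} l → (∀ {x y} → Next x y l → R x y) → Linked R l
next⇒linked []          _ = []
next⇒linked (_ ∷ [])    _ = [-]
next⇒linked (_ ∷ _ ∷ _) R = R here ∷ next⇒linked _ (R ∘ there)

next? : ∀ (x y : Fin r) l → Dec (Next x y l)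
next? x y []          = no λ ()
next? x y (_ ∷ [])    = no λ { (there ()) }
next? x y (a ∷ b ∷ l) with (x ≟ a) ×-dec (y ≟ b) | next? x y (b ∷ l)
... | yes (refl , refl) | _        = yes here
... | no  _             | yes n    = yes (there n)
... | no  ¬here         | no ¬next = no λ { here → ¬here (refl , refl) ; (there n) → ¬next n }

interior-∷-∷ʳ : ∀ {A : Set} {u₁ uₖ u : A} {us} → u ∈ us → Interior (u₁ ∷ (us ∷ʳ uₖ)) u
interior-∷-∷ʳ {us = us} u∈us = pred (∈-++⁺ˡ u∈us) , succ u∈us
  where
  pred : ∀ {x w l} → x ∈ l → ∃ λ y → Next y x (w ∷ l)
  pred (here refl) = _ , here
  pred (there p)   = _ , there (proj₂ (pred p))

  succ : ∀ {w l t x} → x ∈ l → ∃ λ y → Next x y (w ∷ (l ∷ʳ t))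
  succ {l = _ ∷ []}    (here refl) = _ , there here
  succ {l = _ ∷ _ ∷ _} (here refl) = _ , there here
  succ                 (there p)   = _ , there (proj₂ (succ p))

-- The predecessor of `u` places it in the tail, and its successor keeps it from being the last
-- vertex.
interior-split : ∀ {A : Set} {l : List A} {u} → Unique l → Interior l u →
                 ∃ λ u₁ → ∃₂ λ us uₖ → l ≡ u₁ ∷ (us ∷ʳ uₖ) × u ∈ us
interior-split {l = []}     ul ((_ , ()) , _)
interior-split {l = u₁ ∷ l} ul ((_ , n) , (_ , n′)) with u∈l ← next-∈-tail n with initLast l
interior-split {l = u₁ ∷ _} ul ((_ , n) , (_ , n′)) | us ∷ʳ′ uₖ with ∈-++⁻ us u∈l
... | inj₁ u∈us        = u₁ , us , uₖ , refl , u∈us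
... | inj₂ (here refl) = contradiction n′ (last-no-succ ul (there (last-∷ʳ us)))

-- A path-circular matroid without graph and relabelling: the paths are indexed by the ground set
-- itself, and a suitable graph is recovered as their union.
record Presentation (M : Matroid n) : Set where
  field
    {order}  : ℕ
    paths    : Fin n → List (Fin order)
    circular : PathCircular paths
    indep⇔   : ∀ X → Matroid.Indep M X ⇔ Matching (stars paths) X

module _ {G : SimpleGraph r} where

  open SimpleGraph G
  open Path

  adj⇒~ : ∀ {p : Path G} {x y} → Adj (vertices p) x y → x ~ y
  adj⇒~ {p} = [ linked⇒next (linked p) , ~-sym ∘ linked⇒next (linked p) ]

  -- Degree 2 makes the two neighbours of an interior vertex on its own path its only neighbours in
  -- `G`, hence on every path. An end of one path that lies on another is its own witness for
  -- `ends`.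
  path-circular-lists : ∀ {P : Fin n → Path G} → IsPathCircular P → PathCircular (vertices ∘ P)
  path-circular-lists {P = P} pc = record
    { unique = distinct ∘ P
    ; compat = λ i j → record { neighbours = nbrs i j ; ends = ends′ i j }
    }
    where
    nbrs : ∀ i j {u v} → Interior (vertices (P i)) u → Adj (vertices (P j)) u v →
           Adj (vertices (P i)) u v
    nbrs i j {u} int adj
      with u₁ , us , uₖ , eq , u∈us ← interior-split (distinct (P i)) int
      with x , y , x≢y , ux , uy ← interior-neighbours (distinct (P i)) int
      with ∣∣≡2⁻ (u ~?_) x≢y (adj⇒~ {P i} ux) (adj⇒~ {P i} uy)
             (proj₁ (pc i u₁ us uₖ eq u u∈us)) (adj⇒~ {P j} adj)
    ... | inj₁ refl = ux
    ... | inj₂ refl = uy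

    ends′ : ∀ i j {u} → u ∈ vertices (P i) → u ∈ vertices (P j) →
            ∃ λ t → End (vertices (P i)) t × t ∈ vertices (P j)
    ends′ i j {u} u∈i u∈j with end-or-interior u∈i
    ... | inj₁ end = u , end , u∈j
    ... | inj₂ int with u₁ , us , uₖ , eq , u∈us ← interior-split (distinct (P i)) int
      with proj₂ (pc i u₁ us uₖ eq u u∈us) j u∈j
    ...   | inj₁ u₁∈j = u₁ , subst (λ l → End l u₁) (sym eq) (inj₁ here) , u₁∈j
    ...   | inj₂ uₖ∈j = uₖ , subst (λ l → End l uₖ) (sym eq) (inj₂ (there (last-∷ʳ us))) , uₖ∈j

∈-image⁺ : ∀ (σ : Fin m ↔ Fin n) X {j} → Inverse.from σ j ∈ˢ X → j ∈ˢ image σ X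
∈-image⁺ σ X {j} p = lookup⇒[]= j _ (trans (lookup∘tabulate _ j) ([]=⇒lookup p))

∈-image⁻ : ∀ (σ : Fin m ↔ Fin n) X {j} → j ∈ˢ image σ X → Inverse.from σ j ∈ˢ X
∈-image⁻ σ X {j} p = lookup⇒[]= _ X (trans (sym (lookup∘tabulate _ j)) ([]=⇒lookup p))

presentation : {M : Matroid n} → PathCircularMatroid M → Presentation M
presentation {n = n} {M = M} pcm = record
  { paths    = L
  ; circular = record { unique = unique ∘ to ; compat = λ i j → compat (to i) (to j) }
  ; indep⇔   = λ X → mk⇔
      (λ ind → matching-comap (λ x _ → to x)
        (λ x p → ∈-image⁺ σ X (subst (_∈ˢ X) (sym (strictlyInverseʳ x)) p))
        (λ {x} {y} _ _ eq → trans (sym (strictlyInverseʳ x)) (trans (cong from eq) (strictlyInverseʳ y)))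
        (λ x _ v p → ∈-stars⁺ L (∈-stars⁻ K p))
        (Equivalence.to (indep⇔ X) ind))
      (λ k → Equivalence.from (indep⇔ X) (matching-comap (λ x _ → from x)
        (λ x p → ∈-image⁻ σ X p)
        (λ {x} {y} _ _ eq → trans (sym (strictlyInverseˡ x)) (trans (cong to eq) (strictlyInverseˡ y)))
        (λ x _ v p → ∈-stars⁺ K (subst (λ y → v ∈ K y) (strictlyInverseˡ x) (∈-stars⁻ L p)))
        k))
  }
  where
  open PathCircularMatroid pcm
  open _≅_ iso renaming (bijection to σ)
  open Inverse σ
  K = Path.vertices ∘ collection
  L = K ∘ to
  open PathCircular (path-circular-lists {P = collection} pathCircular)

module Union {L : Fin n → List (Fin r)} (pc : PathCircular L) where

  open PathCircular pc

  -- With no edges besides those of the paths, an interior vertex has exactly its two neighbours on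
  -- one path, as `compat` lets no other path add a third.
  unionGraph : SimpleGraph r
  unionGraph = record
    { _~_      = λ x y → ∃ λ i → Adj (L i) x y
    ; _~?_     = λ x y → any? λ i → next? x y (L i) ⊎-dec next? y x (L i)
    ; ~-sym    = λ (i , xy) → i , adj-sym xy
    ; ~-irrefl = λ { refl (i , xx) → adj-irrefl (unique i) xx }
    }

  unionPath : Fin n → Path unionGraph
  unionPath i = record
    { vertices = L i
    ; distinct = unique i
    ; linked   = next⇒linked (L i) (λ n → i , inj₁ n)
    }

  union-circular : IsPathCircular unionPath
  union-circular i u₁ us uₖ eq u u∈us = degree≡2 , end
    where
    int : Interior (L i) u
    int = subst (λ l → Interior l u) (sym eq) (interior-∷-∷ʳ u∈us)

    degree≡2 : SimpleGraph.degree unionGraph u ≡ 2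
    degree≡2 with x , y , x≢y , ux , uy ← interior-neighbours (unique i) int =
      ∣∣≡2⁺ (SimpleGraph._~?_ unionGraph u) x≢y (i , ux) (i , uy)
        (λ (j , uv) → at-most-two-neighbours (unique i) x≢y ux uy (_▷_.neighbours (compat i j) int uv))

    end : ∀ j → u ∈ L j → u₁ ∈ L j ⊎ uₖ ∈ L j
    end j u∈j with _▷_.ends (compat i j) (interior-∈ int) u∈j
    ... | t , end-t , t∈j with subst (λ l → End l t) eq end-t
    ...   | inj₁ here = inj₁ t∈j
    ...   | inj₂ f    = inj₂ (subst (_∈ L j) (last-functional f (there (last-∷ʳ us))) t∈j)

presented : {M : Matroid n} → Presentation M → PathCircularMatroid M
presented {M = M} pres = record
  { graph        = unionGraph
  ; collection   = unionPath
  ; pathCircular = union-circular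
  ; iso          = record
    { bijection = ↔-id _
    ; indep⇔    = λ X → subst (λ Y → Matroid.Indep M X ⇔ Matching (stars paths) Y)
                          (sym (tabulate∘lookup X)) (indep⇔ X)
    }
  }
  where
  open Presentation pres
  open Union circular

-- Deletion and contraction

deletion : (M : Matroid (suc n)) → Presentation M → ∀ e → Presentation (M \\ e)
deletion M pres e = record
  { paths    = paths ∘ punchIn e
  ; circular = record
    { unique = unique ∘ punchIn e ; compat = λ i j → compat (punchIn e i) (punchIn e j) }
  ; indep⇔   = λ X → delete-matching paths e X ⇔-∘ indep⇔ (insertAt X e outside)
  }
  where
  open Presentation pres
  open PathCircular circular

-- The vertex set is kept: `z` merely lies on no path any more. Extending first and then removing
-- `z` gives the paths that `contract-matching` asks for.
contraction : (M : Matroid (suc n)) (pres : Presentation M) → ∀ e ind {z as} →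
              Presentation.paths pres e ≡ z ∷ as → Presentation (slice M e inside ind)
contraction M pres e ind {z} {as} eq = record
  { paths    = remove ∘ proj₁ ∘ ext
  ; circular = record
    { unique = λ i → unique-remove (unique⁺ (proj₂ (ext i)))
    ; compat = λ i j → contract-▷ (proj₂ (ext i)) (proj₂ (ext j)) (unique _) (unique _)
        (compat _ _) (p▷e i) (e▷p i) (p▷e j) (e▷p j)
    }
  ; indep⇔   = λ X → contract-matching paths e eq circular _ (λ {i} → mk⇔ (to i) (from i)) X
                       ⇔-∘ indep⇔ (insertAt X e inside)
  }
  where
  open Presentation pres
  open PathCircular circular
  open Contract _≟_ z as (subst Unique eq (unique e))
  open Extension

  q = paths ∘ punchIn e

  e▷p : ∀ i → z ∷ as ▷ q i
  e▷p i = subst (_▷ q i) eq (compat e (punchIn e i))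

  p▷e : ∀ i → q i ▷ z ∷ as
  p▷e i = subst (q i ▷_) eq (compat (punchIn e i) e)

  ext : ∀ i → ∃ (Extension (q i))
  ext i = extend (q i) (unique (punchIn e i)) (e▷p i) (p▷e i)

  to : ∀ i {v} → v ∈ remove (proj₁ (ext i)) →
       v ≢ z × (v ∈ q i ⊎ ∃ λ c → Next c v (paths e) × c ∈ q i)
  to i v∈ with v∈⁺ , v≢z ← ∈-remove⁻ (proj₁ (ext i)) v∈ = v≢z ,
    Sum.map id (λ (c , J) → c , subst (Next c _) (sym eq) (Jump.next J) , Jump.c∈q J)
      (∈⁻ (proj₂ (ext i)) v∈⁺)

  from : ∀ i {v} → v ≢ z × (v ∈ q i ⊎ ∃ λ c → Next c v (paths e) × c ∈ q i) →
         v ∈ remove (proj₁ (ext i))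
  from i (v≢z , inj₁ v∈)            = ∈-remove⁺ (⊆⁺ (proj₂ (ext i)) v∈) v≢z
  from i (v≢z , inj₂ (c , n , c∈)) =
    ∈-remove⁺ (next-∈⁺ (proj₂ (ext i)) (subst (Next c _) eq n) c∈) v≢z

-- A matching of the single element `e` selects a vertex of its path, which is therefore not null.
nonloop-path : (M : Matroid (suc n)) (pres : Presentation M) → ∀ e → Matroid.Indep M ⁅ e ⁆ →
               ∃₂ λ z as → Presentation.paths pres e ≡ z ∷ as
nonloop-path M pres e ind with Presentation.paths pres e | vertex∈
  where
  open Presentation pres
  k = Equivalence.to (indep⇔ ⁅ e ⁆) ind
  vertex∈ : Matching.match k e (x∈⁅x⁆ e) ∈ paths e
  vertex∈ = ∈-stars⁻ paths (Matching.match-∈ k e (x∈⁅x⁆ e))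
... | z ∷ as | _ = z , as , refl

theorem1p3 : ∀ {n : ℕ} (M : Matroid (suc n)) → PathCircularMatroid M → (e : Fin (suc n)) → PathCircularMatroid (M \\ e) × PathCircularMatroid (M // e)
theorem1p3 M pcm e = presented (deletion M pres e) , presented contracted
  where
  pres : Presentation M
  pres = presentation pcm

  contracted : Presentation (M // e)
  contracted with Matroid.indep? M ⁅ e ⁆
  -- A loop is contracted by deleting it.
  ... | no  _   = deletion M pres e
  ... | yes ind = contraction M pres e _ (proj₂ (proj₂ (nonloop-path M pres e ind)))
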